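{- In IITT, for any well-formed context $\Delta$, the algorithmic equality relations are partial equivalence relations (symmetric and transitive) on well-typed expressions: (a) $\Delta\vdash T\Longleftrightarrow_{\mathsf{ty}}T'$ is symmetric and transitive on the set of $T$ with $\Delta\vdash T$; (b) for each $T$ with $\Delta\vdash T$, $\Delta\vdash t\Longleftrightarrow_{\mathsf{tm}}t':T$ is symmetric and transitive on the set of $t$ with $\Delta\vdash t:T$; (c) the relation "$\Delta\vdash n\Longleftrightarrow_{\mathsf{ne}}n':U$ for some $U$" is symmetric and transitive on the set of expressions typable in $\Delta$.
   Context: Irrelevant Intensional Type Theory (IITT) is defined as follows. Sorts are $\mathsf{Set}_k$ ($k\in\mathbb{N}$), with $\mathsf{Axiom}=\{(\mathsf{Set}_i,\mathsf{Set}_{i+1})\}$ and $\mathsf{Rule}=\{(\mathsf{Set}_i,\mathsf{Set}_j,\mathsf{Set}_{\max(i,j)})\}$. Annotations $\star\in\{:,\div\}$ (relevant, irrelevant). Expressions: $t,u,T,U ::= s \mid (x\star U)\to^{s,s'}T \mid x \mid \lambda x\star U.\,t \mid t\star u$ (relevant/irrelevant dependent function types annotated with domain sort $s$ and codomain sort $s'$; abstractions; relevant application $t\,u$ and irrelevant application $t\div u$), modulo $\alpha$-equivalence; $[u/x]t$ is substitution. Contexts $\Gamma ::= ()\mid\Gamma.x\star T$. Resurrection $\Gamma^\oplus$ turns every $x\div T$ into $x:T$. Abbreviations: $\Gamma\vdash t\div T$ means $\Gamma^\oplus\vdash t:T$; $\Gamma\vdash t=t'\div T$ means $\Gamma\vdash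 t\div T$ and $\Gamma\vdash t'\div T$; $\Gamma\vdash T$ means $\Gamma\vdash T:s$ for some sort $s$; $\Gamma\vdash T=T'$ means $\Gamma\vdash T=T':s$ for some $s$. Rules: $\vdash()$; from $\vdash\Gamma$, $\Gamma\vdash T$ infer $\vdash\Gamma.x\star T$; from $\vdash\Gamma$, $(s,s')\in\mathsf{Axiom}$ infer $\Gamma\vdash s:s'$; from $\Gamma\vdash U:s_1$, $\Gamma.x\star U\vdash T:s_2$, $(s_1,s_2,s_3)\in\mathsf{Rule}$ infer $\Gamma\vdash(x\star U)\to^{s_1,s_2}T:s_3$; from $\vdash\Gamma$, $(x:U)\in\Gamma$ infer $\Gamma\vdash x:U$; from $\Gamma.x\star U\vdash t:T$, $\Gamma\vdash(x\star U)\to^{s,s'}T$ infer $\Gamma\vdash\lambda x\star U.t:(x\star U)\to^{s,s'}T$; from $\Gamma\vdash t:(x\star U)\to^{s,s'}T$, $\Gamma\vdash u\star U$ infer $\Gamma\vdash t\star u:[u/x]T$; from $\Gamma\vdash t:T$, $\Gamma\vdash T=T'$ infer $\Gamma\vdash t:T'$; $\beta$: from $\Gamma.x\star U\vdash t:T$, $\Gamma\vdash u\star U$ infer $\Gamma\vdash(\lambda x\star U.t)\star u=[u/x]t:[u/x]T$; $\eta$: from $\Gamma\vdash t:(x\star U)\to^{s,s'}T$ infer $\Gamma\vdash t=\lambda x\star U.(t\star x):(x\star U)\to^{s,s'}T$; reflexivity, symmetry, transitivity; congruence for function types (from $\Gamma\vdash U=U':s_1$, $\Gamma.x\star U\vdash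 T=T':s_2$, $(s_1,s_2,s_3)\in\mathsf{Rule}$), for abstractions (from $\Gamma\vdash U=U':s_1$, $\Gamma.x\star U\vdash T:s_2$, $\Gamma.x\star U\vdash t=t':T$ infer $\Gamma\vdash\lambda x\star U.t=\lambda x\star U'.t':(x\star U)\to^{s_1,s_2}T$), for application (from $\Gamma\vdash t=t':(x\star U)\to^{s,s'}T$ and $\Gamma\vdash u=u'\star U$ infer $\Gamma\vdash t\star u=t'\star u':[u/x]T$); conversion: from $\Gamma\vdash t=t':T$, $\Gamma\vdash T=T'$ infer $\Gamma\vdash t=t':T'$. Weak head normal forms $a,A ::= s\mid(x\star U)\to^{s,s'}T\mid\lambda x\star U.t\mid n$; neutrals $n,N ::= x\mid n\star u$. Weak head evaluation: $a\searrow a$ for whnf $a$; if $t\searrow f$ and $f\,@^\star u\searrow a$ then $t\star u\searrow a$; if $[u/x]t\searrow a$ then $(\lambda x\star U.t)\,@^\star u\searrow a$; $n\,@^\star u\searrow n\star u$. Algorithmic equality (mutually inductive; long arrows on whnf types): Type equality: $\Delta\vdash T\Longleftrightarrow_{\mathsf{ty}}T'$ if $T\searrow A$, $T'\searrow A'$, $\Delta\vdash A\longleftrightarrow_{\mathsf{ty}}A'$; $\Delta\vdash s\longleftrightarrow_{\mathsf{ty}}s$; $\Delta\vdash(x\star U)\to^{s,s'}T\longleftrightarrow_{\mathsf{ty}}(x\star U')\to^{s,s'}T'$ if $\Delta\vdash U\Longleftrightarrow_{\mathsf{ty}}U'$ and $\Delta.x\star U\vdash T\Longleftrightarrow_{\mathsf{ty}}T'$;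 $\Delta\vdash N\longleftrightarrow_{\mathsf{ty}}N'$ for neutrals if $\Delta\vdash N\Longleftrightarrow_{\mathsf{ne}}N':T$ for some $T$. Structural equality (type is output): $\Delta\vdash x\Longleftrightarrow_{\mathsf{ne}}x:T$ if $(x:T)\in\Delta$; $\Delta\vdash n\,u\Longleftrightarrow_{\mathsf{ne}}n'\,u':[u/x]T$ if $\Delta\vdash n\longleftrightarrow_{\mathsf{ne}}n':(x:U)\to^{s,s'}T$ and $\Delta\vdash u\Longleftrightarrow_{\mathsf{tm}}u':U$; $\Delta\vdash n\div u\Longleftrightarrow_{\mathsf{ne}}n'\div u':[u/x]T$ if $\Delta\vdash n\longleftrightarrow_{\mathsf{ne}}n':(x\div U)\to^{s,s'}T$; $\Delta\vdash n\longleftrightarrow_{\mathsf{ne}}n':A$ if $\Delta\vdash n\Longleftrightarrow_{\mathsf{ne}}n':T$ and $T\searrow A$. Type-directed equality: $\Delta\vdash t\Longleftrightarrow_{\mathsf{tm}}t':T$ if $T\searrow A$ and $\Delta\vdash t\longleftrightarrow_{\mathsf{tm}}t':A$; $\Delta\vdash t\longleftrightarrow_{\mathsf{tm}}t':(x\star U)\to^{s,s'}T$ if $\Delta.x\star U\vdash t\star x\Longleftrightarrow_{\mathsf{tm}}t'\star x:T$; $\Delta\vdash T\longleftrightarrow_{\mathsf{tm}}T':s$ if $\Delta\vdash T\Longleftrightarrow_{\mathsf{ty}}T'$; $\Delta\vdash t\longleftrightarrow_{\mathsf{tm}}t':N$ for neutral $N$ if $t\searrow n$, $t'\searrow n'$,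 and $\Delta\vdash n\Longleftrightarrow_{\mathsf{ne}}n':T$ for some $T$. -}

module Defs where

open import Data.Nat using (ℕ; zero; suc; _⊔_)
open import Data.Product using (Σ; ∃; _×_; _,_)

-- Syntax of IITT (de Bruijn indices; α-equivalence is syntactic equality)

-- Annotations: rel = ":" (relevant), irr = "÷" (irrelevant)
data Ann : Set where
  rel irr : Ann

-- Sorts Set_k are represented by their level k : ℕ.
data Tm : Set where
  sort : ℕ → Tm
  pi   : Ann → ℕ → ℕ → Tm → Tm → Tm      -- (x ⋆ U) →^{Set_i , Set_j} T  (T binds x)
  var  : ℕ → Tm
  lam  : Ann → Tm → Tm → Tm              -- λ x ⋆ U . t  (t binds x)
  app  : Ann → Tm → Tm → Tm

liftR : (ℕ → ℕ) → ℕ → ℕ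
liftR ρ zero    = zero
liftR ρ (suc n) = suc (ρ n)

ren : (ℕ → ℕ) → Tm → Tm
ren ρ (sort k)       = sort k
ren ρ (pi a i j U T) = pi a i j (ren ρ U) (ren (liftR ρ) T)
ren ρ (var x)        = var (ρ x)
ren ρ (lam a U t)    = lam a (ren ρ U) (ren (liftR ρ) t)
ren ρ (app a t u)    = app a (ren ρ t) (ren ρ u)

wk : Tm → Tm
wk = ren suc

exts : (ℕ → Tm) → ℕ → Tm
exts σ zero    = var zero
exts σ (suc n) = wk (σ n)

sub : (ℕ → Tm) → Tm → Tm
sub σ (sort k)       = sort k
sub σ (pi a i j U T) = pi a i j (sub σ U) (sub (exts σ) T)
sub σ (var x)        = σ x
sub σ (lam a U t)    = lam a (sub σ U) (sub (exts σ) t)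
sub σ (app a t u)    = app a (sub σ t) (sub σ u)

single : Tm → ℕ → Tm
single u zero    = u
single u (suc n) = var n

_[_] : Tm → Tm → Tm
t [ u ] = sub (single u) t

infixl 5 _▸_
data Ctx : Set where
  ε   : Ctx
  _▸_ : Ctx → Ann × Tm → Ctx

_⊕ : Ctx → Ctx
ε ⊕ = ε
(Γ ▸ (a , T)) ⊕ = (Γ ⊕) ▸ (rel , T)

data _∋_∶_ : Ctx → ℕ → Tm → Set where
  here  : ∀ {Γ T} → (Γ ▸ (rel , T)) ∋ zero ∶ wk T
  there : ∀ {Γ B x T} → Γ ∋ x ∶ T → (Γ ▸ B) ∋ suc x ∶ wk T

mutual
  data ⊢_ : Ctx → Set where
    wf-ε : ⊢ ε
    wf-▸ : ∀ {Γ a T k} → ⊢ Γ → Γ ⊢ T ∶ sort k → ⊢ (Γ ▸ (a , T))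

  _⊢_∶[_]_ : Ctx → Tm → Ann → Tm → Set
  Γ ⊢ u ∶[ rel ] U = Γ ⊢ u ∶ U
  Γ ⊢ u ∶[ irr ] U = (Γ ⊕) ⊢ u ∶ U

  _⊢_≡_∶[_]_ : Ctx → Tm → Tm → Ann → Tm → Set
  Γ ⊢ u ≡ u' ∶[ rel ] U = Γ ⊢ u ≡ u' ∶ U
  Γ ⊢ u ≡ u' ∶[ irr ] U = ((Γ ⊕) ⊢ u ∶ U) × ((Γ ⊕) ⊢ u' ∶ U)

  data _⊢_∶_ : Ctx → Tm → Tm → Set where
    ty-sort : ∀ {Γ i} → ⊢ Γ → Γ ⊢ sort i ∶ sort (suc i)
    ty-pi   : ∀ {Γ a i j U T} → Γ ⊢ U ∶ sort i → (Γ ▸ (a , U)) ⊢ T ∶ sort j →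
              Γ ⊢ pi a i j U T ∶ sort (i ⊔ j)
    ty-var  : ∀ {Γ x U} → ⊢ Γ → Γ ∋ x ∶ U → Γ ⊢ var x ∶ U
    ty-lam  : ∀ {Γ a i j k U T t} → (Γ ▸ (a , U)) ⊢ t ∶ T →
              Γ ⊢ pi a i j U T ∶ sort k → Γ ⊢ lam a U t ∶ pi a i j U T
    ty-app  : ∀ {Γ a i j U T t u} → Γ ⊢ t ∶ pi a i j U T → Γ ⊢ u ∶[ a ] U →
              Γ ⊢ app a t u ∶ (T [ u ])
    ty-conv : ∀ {Γ t T T' k} → Γ ⊢ t ∶ T → Γ ⊢ T ≡ T' ∶ sort k → Γ ⊢ t ∶ T'

  data _⊢_≡_∶_ : Ctx → Tm → Tm → Tm → Set where
    eq-β     : ∀ {Γ a U T t u} → (Γ ▸ (a , U)) ⊢ t ∶ T → Γ ⊢ u ∶[ a ] U →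
               Γ ⊢ app a (lam a U t) u ≡ (t [ u ]) ∶ (T [ u ])
    eq-η     : ∀ {Γ a i j U T t} → Γ ⊢ t ∶ pi a i j U T →
               Γ ⊢ t ≡ lam a U (app a (wk t) (var zero)) ∶ pi a i j U T
    eq-refl  : ∀ {Γ t T} → Γ ⊢ t ∶ T → Γ ⊢ t ≡ t ∶ T
    eq-sym   : ∀ {Γ t t' T} → Γ ⊢ t ≡ t' ∶ T → Γ ⊢ t' ≡ t ∶ T
    eq-trans : ∀ {Γ t t' t'' T} → Γ ⊢ t ≡ t' ∶ T → Γ ⊢ t' ≡ t'' ∶ T → Γ ⊢ t ≡ t'' ∶ T
    eq-pi    : ∀ {Γ a i j U U' T T'} → Γ ⊢ U ≡ U' ∶ sort i →
               (Γ ▸ (a , U)) ⊢ T ≡ T' ∶ sort j →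
               Γ ⊢ pi a i j U T ≡ pi a i j U' T' ∶ sort (i ⊔ j)
    eq-lam   : ∀ {Γ a i j U U' T t t'} → Γ ⊢ U ≡ U' ∶ sort i →
               (Γ ▸ (a , U)) ⊢ T ∶ sort j → (Γ ▸ (a , U)) ⊢ t ≡ t' ∶ T →
               Γ ⊢ lam a U t ≡ lam a U' t' ∶ pi a i j U T
    eq-app   : ∀ {Γ a i j U T t t' u u'} → Γ ⊢ t ≡ t' ∶ pi a i j U T →
               Γ ⊢ u ≡ u' ∶[ a ] U → Γ ⊢ app a t u ≡ app a t' u' ∶ (T [ u ])
    eq-conv  : ∀ {Γ t t' T T' k} → Γ ⊢ t ≡ t' ∶ T → Γ ⊢ T ≡ T' ∶ sort k →
               Γ ⊢ t ≡ t' ∶ T'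

_⊢Ty_ : Ctx → Tm → Set
Γ ⊢Ty T = Σ ℕ λ k → Γ ⊢ T ∶ sort k

Typable : Ctx → Tm → Set
Typable Γ t = ∃ λ V → Γ ⊢ t ∶ V

data Ne : Tm → Set where
  ne-var : ∀ {x} → Ne (var x)
  ne-app : ∀ {a n u} → Ne n → Ne (app a n u)

data Whnf : Tm → Set where
  wh-sort : ∀ {k} → Whnf (sort k)
  wh-pi   : ∀ {a i j U T} → Whnf (pi a i j U T)
  wh-lam  : ∀ {a U t} → Whnf (lam a U t)
  wh-ne   : ∀ {n} → Ne n → Whnf n

mutual
  data _↘_ : Tm → Tm → Set where
    ev-whnf : ∀ {a} → Whnf a → a ↘ a
    ev-app  : ∀ {s t u f r} → t ↘ f → f ·[ s ] u ↘ r → app s t u ↘ r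

  data _·[_]_↘_ : Tm → Ann → Tm → Tm → Set where
    ev-β  : ∀ {s U t u r} → (t [ u ]) ↘ r → lam s U t ·[ s ] u ↘ r
    ev-ne : ∀ {s n u} → Ne n → n ·[ s ] u ↘ app s n u

mutual
  data _⊢_⟺ty_ : Ctx → Tm → Tm → Set where
    ty-eval : ∀ {Δ T T' A A'} → T ↘ A → T' ↘ A' → Δ ⊢ A ⟷ty A' → Δ ⊢ T ⟺ty T'

  data _⊢_⟷ty_ : Ctx → Tm → Tm → Set where
    tyw-sort : ∀ {Δ k} → Δ ⊢ sort k ⟷ty sort k
    tyw-pi   : ∀ {Δ a i j U U' T T'} → Δ ⊢ U ⟺ty U' → (Δ ▸ (a , U)) ⊢ T ⟺ty T' →
               Δ ⊢ pi a i j U T ⟷ty pi a i j U' T'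
    tyw-ne   : ∀ {Δ N N' T} → Ne N → Ne N' → Δ ⊢ N ⟺ne N' ∶ T → Δ ⊢ N ⟷ty N'

  -- Δ ⊢ n ⟺ne n' : T   (T is output)
  data _⊢_⟺ne_∶_ : Ctx → Tm → Tm → Tm → Set where
    ne-var     : ∀ {Δ x T} → Δ ∋ x ∶ T → Δ ⊢ var x ⟺ne var x ∶ T
    ne-app-rel : ∀ {Δ n n' u u' i j U T} → Δ ⊢ n ⟷ne n' ∶ pi rel i j U T →
                 Δ ⊢ u ⟺tm u' ∶ U → Δ ⊢ app rel n u ⟺ne app rel n' u' ∶ (T [ u ])
    ne-app-irr : ∀ {Δ n n' u u' i j U T} → Δ ⊢ n ⟷ne n' ∶ pi irr i j U T →
                 Δ ⊢ app irr n u ⟺ne app irr n' u' ∶ (T [ u ])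

  data _⊢_⟷ne_∶_ : Ctx → Tm → Tm → Tm → Set where
    ne-eval : ∀ {Δ n n' T A} → Δ ⊢ n ⟺ne n' ∶ T → T ↘ A → Δ ⊢ n ⟷ne n' ∶ A

  data _⊢_⟺tm_∶_ : Ctx → Tm → Tm → Tm → Set where
    tm-eval : ∀ {Δ t t' T A} → T ↘ A → Δ ⊢ t ⟷tm t' ∶ A → Δ ⊢ t ⟺tm t' ∶ T

  data _⊢_⟷tm_∶_ : Ctx → Tm → Tm → Tm → Set where
    tmw-pi   : ∀ {Δ t t' a i j U T} →
               (Δ ▸ (a , U)) ⊢ app a (wk t) (var zero) ⟺tm app a (wk t') (var zero) ∶ T →
               Δ ⊢ t ⟷tm t' ∶ pi a i j U T
    tmw-sort : ∀ {Δ T T' k} → Δ ⊢ T ⟺ty T' → Δ ⊢ T ⟷tm T' ∶ sort k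
    tmw-ne   : ∀ {Δ t t' n n' N T} → Ne N → t ↘ n → t' ↘ n' → Ne n → Ne n' →
               Δ ⊢ n ⟺ne n' ∶ T → Δ ⊢ t ⟷tm t' ∶ N

NeRel : Ctx → Tm → Tm → Set
NeRel Δ n n' = ∃ λ U → Δ ⊢ n ⟺ne n' ∶ U

SymOn : (Tm → Set) → (Tm → Tm → Set) → Set
SymOn P R = ∀ {x y} → P x → P y → R x y → R y x

TransOn : (Tm → Set) → (Tm → Tm → Set) → Set
TransOn P R = ∀ {x y z} → P x → P y → P z → R x y → R y z → R x z

PEROn : (Tm → Set) → (Tm → Tm → Set) → Set
PEROn P R = SymOn P R × TransOn P R

{-# OPTIONS --safe #-}
module Submission where

open import Defs
open import Data.Empty using (⊥; ⊥-elim)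
open import Data.Nat using (ℕ; zero; suc; _<_; s≤s)
open import Data.Nat.Properties
  using (suc-injective; ≤-refl; ≤-trans; <-≤-trans; ≤-reflexive; n≤1+n)
open import Data.Product using (∃; _×_; _,_; proj₁; proj₂)
open import Data.Sum using (_⊎_; inj₁; inj₂)
open import Relation.Binary.Construct.Closure.Equivalence using (EqClosure; symmetric; return)
  renaming (gmap to ≃-gmap)
open import Relation.Binary.Construct.Closure.ReflexiveTransitive using (Star; _◅_; _◅◅_; gmap)
  renaming (ε to done)
open import Relation.Binary.Construct.Closure.Symmetric using (fwd; bwd)
open import Relation.Binary.PropositionalEquality
  using (_≡_; refl; sym; trans; cong; cong₂; subst; subst₂)

-- Algorithmic equality compares terms guided by the weak head normal forms of types, and swapping
-- or composing derivations replaces these types by judgmentally equal ones. So one has to know that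
-- equal types have weak head normal forms of the same shape with equal components. No normalization
-- argument is needed for this: erasing levels, domains of abstractions and everything irrelevant
-- maps judgmental equality into untyped βη-conversion, which is confluent, and standardization
-- turns a reduction to a rigid term (universe, function type, neutral) into weak head evaluation.
-- Symmetry and transitivity are then shown for derivations over two contexts with convertible types.

-- The term `λx:U. (λy:V. t) x` contracts by β and by η to abstractions with domains `U` and `V`, so
-- raw βη-reduction is not confluent while domains are kept. Equality at `÷` identifies any two
-- arguments of the right type, so it cannot become untyped conversion while irrelevant arguments
-- are kept. The price of erasing both is paid on the way back: irrelevant β-steps become invisible,
-- and evaluation of typed terms is recovered from head reduction of erasures only with a measure
-- that bounds them. Function types force the two contexts: codomains are compared under the left
-- domain only, which is a different one after reversal and in the second of two composed
-- derivations.

infixl 7 _[_]°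
infix 4 _⇒_ _⇒*_ _≃_ _→ʰ_ _⊳_

-- Erased terms and their substitution calculus.

data Tm° : Set where
  ⋆°   : Tm°
  pi°  : Ann → Tm° → Tm° → Tm°
  var° : ℕ → Tm°
  lam° : Tm° → Tm°
  app° : Tm° → Tm° → Tm°

ren° : (ℕ → ℕ) → Tm° → Tm°
ren° ρ ⋆°          = ⋆°
ren° ρ (pi° a U T) = pi° a (ren° ρ U) (ren° (liftR ρ) T)
ren° ρ (var° x)    = var° (ρ x)
ren° ρ (lam° t)    = lam° (ren° (liftR ρ) t)
ren° ρ (app° t u)  = app° (ren° ρ t) (ren° ρ u)

wk° : Tm° → Tm°
wk° = ren° suc

exts° : (ℕ → Tm°) → ℕ → Tm°
exts° σ zero    = var° zero
exts° σ (suc x) = wk° (σ x)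

sub° : (ℕ → Tm°) → Tm° → Tm°
sub° σ ⋆°          = ⋆°
sub° σ (pi° a U T) = pi° a (sub° σ U) (sub° (exts° σ) T)
sub° σ (var° x)    = σ x
sub° σ (lam° t)    = lam° (sub° (exts° σ) t)
sub° σ (app° t u)  = app° (sub° σ t) (sub° σ u)

single° : Tm° → ℕ → Tm°
single° u zero    = u
single° u (suc x) = var° x

_[_]° : Tm° → Tm° → Tm°
t [ u ]° = sub° (single° u) t

-- Commutation laws take the composite as a parameter, specified pointwise, so that no separate
-- congruence lemmas (or function extensionality) are needed under binders.

liftR-∘ : ∀ {ρ ρ' ξ} → (∀ x → ρ' (ρ x) ≡ ξ x) → ∀ x → liftR ρ' (liftR ρ x) ≡ liftR ξ x
liftR-∘ h zero    = refl
liftR-∘ h (suc x) = cong suc (h x)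

ren-ren° : ∀ {ρ ρ' ξ} → (∀ x → ρ' (ρ x) ≡ ξ x) → ∀ t → ren° ρ' (ren° ρ t) ≡ ren° ξ t
ren-ren° h ⋆°          = refl
ren-ren° h (pi° a U T) = cong₂ (pi° a) (ren-ren° h U) (ren-ren° (liftR-∘ h) T)
ren-ren° h (var° x)    = cong var° (h x)
ren-ren° h (lam° t)    = cong lam° (ren-ren° (liftR-∘ h) t)
ren-ren° h (app° t u)  = cong₂ app° (ren-ren° h t) (ren-ren° h u)

ren-wk° : ∀ ρ t → ren° (liftR ρ) (wk° t) ≡ wk° (ren° ρ t)
ren-wk° ρ t = trans (ren-ren° (λ _ → refl) t) (sym (ren-ren° (λ _ → refl) t))

sub-ren° : ∀ {ρ σ τ} → (∀ x → σ (ρ x) ≡ τ x) → ∀ t → sub° σ (ren° ρ t) ≡ sub° τ t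
sub-ren° h ⋆°          = refl
sub-ren° h (pi° a U T) = cong₂ (pi° a) (sub-ren° h U)
  (sub-ren° (λ { zero → refl ; (suc x) → cong wk° (h x) }) T)
sub-ren° h (var° x)    = h x
sub-ren° h (lam° t)    = cong lam° (sub-ren° (λ { zero → refl ; (suc x) → cong wk° (h x) }) t)
sub-ren° h (app° t u)  = cong₂ app° (sub-ren° h t) (sub-ren° h u)

exts-ren° : ∀ {ρ σ τ} → (∀ x → ren° ρ (σ x) ≡ τ x) →
            ∀ x → ren° (liftR ρ) (exts° σ x) ≡ exts° τ x
exts-ren° h zero    = refl
exts-ren° {ρ} {σ} h (suc x) = trans (ren-wk° ρ (σ x)) (cong wk° (h x))

ren-sub° : ∀ {ρ σ τ} → (∀ x → ren° ρ (σ x) ≡ τ x) → ∀ t → ren° ρ (sub° σ t) ≡ sub° τ t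
ren-sub° h ⋆°          = refl
ren-sub° h (pi° a U T) = cong₂ (pi° a) (ren-sub° h U) (ren-sub° (exts-ren° h) T)
ren-sub° h (var° x)    = h x
ren-sub° h (lam° t)    = cong lam° (ren-sub° (exts-ren° h) t)
ren-sub° h (app° t u)  = cong₂ app° (ren-sub° h t) (ren-sub° h u)

sub-wk° : ∀ σ t → sub° (exts° σ) (wk° t) ≡ wk° (sub° σ t)
sub-wk° σ t = trans (sub-ren° (λ _ → refl) t) (sym (ren-sub° (λ _ → refl) t))

exts-sub° : ∀ {σ τ υ} → (∀ x → sub° τ (σ x) ≡ υ x) → ∀ x → sub° (exts° τ) (exts° σ x) ≡ exts° υ x
exts-sub° h zero = refl
exts-sub° {σ} {τ} h (suc x) = trans (sub-wk° τ (σ x)) (cong wk° (h x))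

sub-sub° : ∀ {σ τ υ} → (∀ x → sub° τ (σ x) ≡ υ x) → ∀ t → sub° τ (sub° σ t) ≡ sub° υ t
sub-sub° h ⋆°          = refl
sub-sub° h (pi° a U T) = cong₂ (pi° a) (sub-sub° h U) (sub-sub° (exts-sub° h) T)
sub-sub° h (var° x)    = h x
sub-sub° h (lam° t)    = cong lam° (sub-sub° (exts-sub° h) t)
sub-sub° h (app° t u)  = cong₂ app° (sub-sub° h t) (sub-sub° h u)

exts-id° : ∀ {σ} → (∀ x → σ x ≡ var° x) → ∀ x → exts° σ x ≡ var° x
exts-id° h zero    = refl
exts-id° h (suc x) = cong wk° (h x)

sub-id° : ∀ {σ} → (∀ x → σ x ≡ var° x) → ∀ t → sub° σ t ≡ t
sub-id° h ⋆°          = refl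
sub-id° h (pi° a U T) = cong₂ (pi° a) (sub-id° h U) (sub-id° (exts-id° h) T)
sub-id° h (var° x)    = h x
sub-id° h (lam° t)    = cong lam° (sub-id° (exts-id° h) t)
sub-id° h (app° t u)  = cong₂ app° (sub-id° h t) (sub-id° h u)

wk-single° : ∀ u t → wk° t [ u ]° ≡ t
wk-single° u t = trans (sub-ren° (λ _ → refl) t) (sub-id° (λ _ → refl) t)

sub-single° : ∀ σ t u → sub° σ (t [ u ]°) ≡ sub° (exts° σ) t [ sub° σ u ]°
sub-single° σ t u = trans (sub-sub° (λ _ → refl) t) (sym (sub-sub° pointwise t))
  where
  pointwise : ∀ x → exts° σ x [ sub° σ u ]° ≡ sub° σ (single° u x)
  pointwise zero    = refl
  pointwise (suc x) = wk-single° _ (σ x)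

ren-single° : ∀ ρ t u → ren° ρ (t [ u ]°) ≡ ren° (liftR ρ) t [ ren° ρ u ]°
ren-single° ρ t u = trans (ren-sub° pointwise t) (sym (sub-ren° (λ _ → refl) t))
  where
  pointwise : ∀ x → ren° ρ (single° u x) ≡ single° (ren° ρ u) (liftR ρ x)
  pointwise zero    = refl
  pointwise (suc x) = refl

lift-wk-single-zero° : ∀ t → ren° (liftR suc) t [ var° zero ]° ≡ t
lift-wk-single-zero° t = trans (sub-ren° (λ _ → refl) t) (sub-id° pointwise t)
  where
  pointwise : ∀ x → single° (var° zero) (liftR suc x) ≡ var° x
  pointwise zero    = refl
  pointwise (suc x) = refl

-- Parallel βη-reduction: strengthening along renamings and the diamond property.

Pullback : (ρ₁ ρ₂ π₁ π₂ : ℕ → ℕ) → Set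
Pullback ρ₁ ρ₂ π₁ π₂ = ∀ x y → ρ₁ x ≡ ρ₂ y → ∃ λ z → x ≡ π₁ z × y ≡ π₂ z

pullback-lift : ∀ {ρ₁ ρ₂ π₁ π₂} → Pullback ρ₁ ρ₂ π₁ π₂ →
                Pullback (liftR ρ₁) (liftR ρ₂) (liftR π₁) (liftR π₂)
pullback-lift p zero    zero    e = zero , refl , refl
pullback-lift p (suc x) (suc y) e with p x y (suc-injective e)
... | z , refl , refl = suc z , refl , refl

pullback-wk : ∀ ρ → Pullback (liftR ρ) suc suc ρ
pullback-wk ρ (suc x) .(ρ x) refl = x , refl , refl

pi°-injective : ∀ {a a' U U' T T'} → pi° a U T ≡ pi° a' U' T' → a ≡ a' × U ≡ U' × T ≡ T'
pi°-injective refl = refl , refl , refl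

var°-injective : ∀ {x y} → var° x ≡ var° y → x ≡ y
var°-injective refl = refl

lam°-injective : ∀ {t u} → lam° t ≡ lam° u → t ≡ u
lam°-injective refl = refl

app°-injective : ∀ {t t' u u'} → app° t u ≡ app° t' u' → t ≡ t' × u ≡ u'
app°-injective refl = refl , refl

-- This serves η. By `pullback-wk`, a term that is both a weakening and an image of `liftR ρ` is the
-- weakening of a `ρ`-image, so the contractum of an η-redex found in a renamed term is itself
-- renamed.
pullback-ren° : ∀ {ρ₁ ρ₂ π₁ π₂} → Pullback ρ₁ ρ₂ π₁ π₂ → ∀ t s → ren° ρ₁ t ≡ ren° ρ₂ s →
                ∃ λ r → t ≡ ren° π₁ r × s ≡ ren° π₂ r
pullback-ren° p ⋆° ⋆° e = ⋆° , refl , refl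
pullback-ren° p (pi° a U T) (pi° b V S) e with pi°-injective e
... | refl , e₁ , e₂ with pullback-ren° p U V e₁ | pullback-ren° (pullback-lift p) T S e₂
... | U₀ , refl , refl | T₀ , refl , refl = pi° a U₀ T₀ , refl , refl
pullback-ren° p (var° x) (var° y) e with p x y (var°-injective e)
... | z , refl , refl = var° z , refl , refl
pullback-ren° p (lam° t) (lam° s) e with pullback-ren° (pullback-lift p) t s (lam°-injective e)
... | r , refl , refl = lam° r , refl , refl
pullback-ren° p (app° t u) (app° s v) e with app°-injective e
... | e₁ , e₂ with pullback-ren° p t s e₁ | pullback-ren° p u v e₂
... | r , refl , refl | w , refl , refl = app° r w , refl , refl

wk°-injective : ∀ t s → wk° t ≡ wk° s → t ≡ s
wk°-injective t s e
  with pullback-ren° {π₁ = λ x → x} {λ x → x} (λ x y e → x , refl , sym (suc-injective e)) t s e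
... | r , refl , refl = refl

-- The η rule contracts after reducing the body; this makes the diamond property provable by
-- induction on the reductions, and covers λx. (λy. t) x ⇒ λy. t both as β and as η.
data _⇒_ : Tm° → Tm° → Set where
  ⇒-⋆   : ⋆° ⇒ ⋆°
  ⇒-pi  : ∀ {a U U' T T'} → U ⇒ U' → T ⇒ T' → pi° a U T ⇒ pi° a U' T'
  ⇒-var : ∀ {x} → var° x ⇒ var° x
  ⇒-lam : ∀ {t t'} → t ⇒ t' → lam° t ⇒ lam° t'
  ⇒-app : ∀ {t t' u u'} → t ⇒ t' → u ⇒ u' → app° t u ⇒ app° t' u'
  ⇒-β   : ∀ {t t' u u'} → t ⇒ t' → u ⇒ u' → app° (lam° t) u ⇒ t' [ u' ]°
  ⇒-η   : ∀ {t s} → t ⇒ app° (wk° s) (var° zero) → lam° t ⇒ s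

⇒-refl : ∀ t → t ⇒ t
⇒-refl ⋆°          = ⇒-⋆
⇒-refl (pi° a U T) = ⇒-pi (⇒-refl U) (⇒-refl T)
⇒-refl (var° x)    = ⇒-var
⇒-refl (lam° t)    = ⇒-lam (⇒-refl t)
⇒-refl (app° t u)  = ⇒-app (⇒-refl t) (⇒-refl u)

⇒-ren : ∀ {t t'} ρ → t ⇒ t' → ren° ρ t ⇒ ren° ρ t'
⇒-ren ρ ⇒-⋆         = ⇒-⋆
⇒-ren ρ (⇒-pi U T)  = ⇒-pi (⇒-ren ρ U) (⇒-ren (liftR ρ) T)
⇒-ren ρ ⇒-var       = ⇒-var
⇒-ren ρ (⇒-lam t)   = ⇒-lam (⇒-ren (liftR ρ) t)
⇒-ren ρ (⇒-app t u) = ⇒-app (⇒-ren ρ t) (⇒-ren ρ u)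
⇒-ren ρ (⇒-β {t' = t'} {u' = u'} t u) =
  subst (_ ⇒_) (sym (ren-single° ρ t' u')) (⇒-β (⇒-ren (liftR ρ) t) (⇒-ren ρ u))
⇒-ren ρ (⇒-η {s = s} t) =
  ⇒-η (subst (λ r → _ ⇒ app° r (var° zero)) (ren-wk° ρ s) (⇒-ren (liftR ρ) t))

⇒-exts : ∀ {σ τ} → (∀ x → σ x ⇒ τ x) → ∀ x → exts° σ x ⇒ exts° τ x
⇒-exts h zero    = ⇒-var
⇒-exts h (suc x) = ⇒-ren suc (h x)

⇒-sub : ∀ {t t' σ τ} → (∀ x → σ x ⇒ τ x) → t ⇒ t' → sub° σ t ⇒ sub° τ t'
⇒-sub h ⇒-⋆         = ⇒-⋆
⇒-sub h (⇒-pi U T)  = ⇒-pi (⇒-sub h U) (⇒-sub (⇒-exts h) T)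
⇒-sub h ⇒-var       = h _
⇒-sub h (⇒-lam t)   = ⇒-lam (⇒-sub (⇒-exts h) t)
⇒-sub h (⇒-app t u) = ⇒-app (⇒-sub h t) (⇒-sub h u)
⇒-sub {τ = τ} h (⇒-β {t' = t'} {u' = u'} t u) =
  subst (_ ⇒_) (sym (sub-single° τ t' u')) (⇒-β (⇒-sub (⇒-exts h) t) (⇒-sub h u))
⇒-sub {τ = τ} h (⇒-η {s = s} t) =
  ⇒-η (subst (λ r → _ ⇒ app° r (var° zero)) (sub-wk° τ s) (⇒-sub (⇒-exts h) t))

⇒-single : ∀ {u u'} → u ⇒ u' → ∀ x → single° u x ⇒ single° u' x
⇒-single h zero    = h
⇒-single h (suc x) = ⇒-var

⇒-[] : ∀ {t t' u u'} → t ⇒ t' → u ⇒ u' → t [ u ]° ⇒ t' [ u' ]°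
⇒-[] t u = ⇒-sub (⇒-single u) t

-- The equation `t ≡ lam° b` allows case analysis when `t` is a stuck expression such as `ren° ρ t`,
-- where matching on `⇒-β` directly would fail to unify.
data AppReduct (t u : Tm°) : Tm° → Set where
  by-app : ∀ {t' u'} → t ⇒ t' → u ⇒ u' → AppReduct t u (app° t' u')
  by-β   : ∀ {b b' u'} → t ≡ lam° b → b ⇒ b' → u ⇒ u' → AppReduct t u (b' [ u' ]°)

appReduct : ∀ {t u s} → app° t u ⇒ s → AppReduct t u s
appReduct (⇒-app t u) = by-app t u
appReduct (⇒-β t u)   = by-β refl t u

ren-lam⁻¹ : ∀ ρ t {b} → ren° ρ t ≡ lam° b → ∃ λ b₀ → t ≡ lam° b₀ × b ≡ ren° (liftR ρ) b₀
ren-lam⁻¹ ρ (lam° t) refl = t , refl , refl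

⇒-ren⁻¹ : ∀ {s} ρ t → ren° ρ t ⇒ s → ∃ λ t' → t ⇒ t' × s ≡ ren° ρ t'
⇒-ren⁻¹ ρ ⋆° ⇒-⋆ = ⋆° , ⇒-⋆ , refl
⇒-ren⁻¹ ρ (pi° a U T) (⇒-pi p q) with ⇒-ren⁻¹ ρ U p | ⇒-ren⁻¹ (liftR ρ) T q
... | U' , p' , refl | T' , q' , refl = pi° a U' T' , ⇒-pi p' q' , refl
⇒-ren⁻¹ ρ (var° x) ⇒-var = var° x , ⇒-var , refl
⇒-ren⁻¹ ρ (lam° t) (⇒-lam p) with ⇒-ren⁻¹ (liftR ρ) t p
... | t' , p' , refl = lam° t' , ⇒-lam p' , refl
⇒-ren⁻¹ ρ (lam° t) (⇒-η {s = s} p) with ⇒-ren⁻¹ (liftR ρ) t p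
-- The argument is `zero` before renaming too, because `liftR ρ` sends no other index to `zero`.
... | app° t₁ (var° zero) , p' , e
  with pullback-ren° (pullback-wk ρ) t₁ s (sym (proj₁ (app°-injective e)))
... | r , refl , refl = r , ⇒-η p' , refl
⇒-ren⁻¹ ρ (app° t u) p with appReduct p
⇒-ren⁻¹ ρ (app° t u) p | by-app q r with ⇒-ren⁻¹ ρ t q | ⇒-ren⁻¹ ρ u r
... | t' , q' , refl | u' , r' , refl = app° t' u' , ⇒-app q' r' , refl
⇒-ren⁻¹ ρ (app° t u) p | by-β e q r with ren-lam⁻¹ ρ t e
... | b , refl , refl with ⇒-ren⁻¹ (liftR ρ) b q | ⇒-ren⁻¹ ρ u r
... | b' , q' , refl | u' , r' , refl = b' [ u' ]° , ⇒-β q' r' , sym (ren-single° ρ b' u')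

data ηReduct (s : Tm°) : Tm° → Set where
  η-redex : ∀ {s'} → s ⇒ s' → ηReduct s (app° (wk° s') (var° zero))
  η-body  : ∀ {b b'} → s ≡ lam° b → b ⇒ b' → ηReduct s b'

-- If `s` is an abstraction, the β-step merely renames its bound variable to the fresh one; shifting
-- and then instantiating by `var° zero` cancel, which leaves a reduct of the body of `s`.
ηReduct-view : ∀ {s c} → app° (wk° s) (var° zero) ⇒ c → ηReduct s c
ηReduct-view {s} p with appReduct p
ηReduct-view {s} p | by-app q ⇒-var with ⇒-ren⁻¹ suc s q
... | s' , q' , refl = η-redex q'
ηReduct-view {s} p | by-β {b' = c} e q ⇒-var with ren-lam⁻¹ suc s e
... | b , refl , refl with ⇒-ren⁻¹ (liftR suc) b q
... | b' , q' , refl = subst (ηReduct _) (sym (lift-wk-single-zero° b')) (η-body refl q')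

Joinable : Tm° → Tm° → Set
Joinable t u = ∃ λ s → t ⇒ s × u ⇒ s

joinable-sym : ∀ {t u} → Joinable t u → Joinable u t
joinable-sym (s , p , q) = s , q , p

-- If the common reduct is still an η-redex, the left side contracts it. Otherwise `s` is an
-- abstraction whose β-step has fired, and both sides meet as abstractions over the same body.
joinable-lam-η : ∀ {b s} → Joinable b (app° (wk° s) (var° zero)) → Joinable (lam° b) s
joinable-lam-η (c , p , q) with ηReduct-view q
... | η-redex q'     = _ , ⇒-η p , q'
... | η-body refl q' = _ , ⇒-lam p , ⇒-lam q'

joinable-η-η : ∀ {s s'} → Joinable (app° (wk° s) (var° zero)) (app° (wk° s') (var° zero)) →
               Joinable s s'
joinable-η-η {s} (c , p , q) with ηReduct-view p
... | η-body refl p' = joinable-lam-η (c , p' , q)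
... | η-redex {s₁} p' = go (ηReduct-view q) refl
  where
  go : ∀ {c s'} → ηReduct s' c → c ≡ app° (wk° s₁) (var° zero) → Joinable s s'
  go (η-redex {s₂} q') e with wk°-injective s₂ s₁ (proj₁ (app°-injective e))
  ... | refl = _ , p' , q'
  go (η-body refl q') refl = _ , p' , ⇒-η q'

diamond : ∀ {t t₁ t₂} → t ⇒ t₁ → t ⇒ t₂ → Joinable t₁ t₂
diamond ⇒-⋆ ⇒-⋆ = ⋆° , ⇒-⋆ , ⇒-⋆
diamond (⇒-pi p q) (⇒-pi p' q') with diamond p p' | diamond q q'
... | _ , r , r' | _ , u , u' = _ , ⇒-pi r u , ⇒-pi r' u'
diamond ⇒-var ⇒-var = _ , ⇒-var , ⇒-var
diamond (⇒-lam p) (⇒-lam q) with diamond p q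
... | _ , r , s = _ , ⇒-lam r , ⇒-lam s
diamond (⇒-lam p) (⇒-η q) = joinable-lam-η (diamond p q)
diamond (⇒-η p) (⇒-lam q) = joinable-sym (joinable-lam-η (diamond q p))
diamond (⇒-η p) (⇒-η q)   = joinable-η-η (diamond p q)
diamond (⇒-app p q) (⇒-app p' q') with diamond p p' | diamond q q'
... | _ , r , r' | _ , u , u' = _ , ⇒-app r u , ⇒-app r' u'
diamond (⇒-β p q) (⇒-β p' q') with diamond p p' | diamond q q'
... | _ , r , r' | _ , u , u' = _ , ⇒-[] r u , ⇒-[] r' u'
diamond (⇒-app (⇒-lam p) q) (⇒-β p' q') with diamond p p' | diamond q q'
... | _ , r , r' | _ , u , u' = _ , ⇒-β r u , ⇒-[] r' u'
diamond (⇒-β p q) (⇒-app (⇒-lam p') q') with diamond p p' | diamond q q'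
... | _ , r , r' | _ , u , u' = _ , ⇒-[] r u , ⇒-β r' u'
-- Instantiating the body `app° (wk° s) (var° zero)` with the argument `u` gives `app° s u`, so the
-- η-contracted application is where the β-contractum leads.
diamond (⇒-app (⇒-η {s = s} p) q) (⇒-β p' q') with diamond p p' | diamond q q'
... | _ , r , r' | _ , u , u' =
  _ , subst (λ f → app° f _ ⇒ _) (wk-single° _ s) (⇒-[] r u) , ⇒-[] r' u'
diamond (⇒-β p q) (⇒-app (⇒-η {s = s} p') q') with diamond p p' | diamond q q'
... | _ , r , r' | _ , u , u' =
  _ , ⇒-[] r u , subst (λ f → app° f _ ⇒ _) (wk-single° _ s) (⇒-[] r' u')

-- Conversion and confluence.

_⇒*_ : Tm° → Tm° → Set
_⇒*_ = Star _⇒_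

_≃_ : Tm° → Tm° → Set
_≃_ = EqClosure _⇒_

strip : ∀ {t t₁ t₂} → t ⇒ t₁ → t ⇒* t₂ → ∃ λ s → t₁ ⇒* s × t₂ ⇒ s
strip p done    = _ , done , p
strip p (q ◅ r) with diamond p q
... | _ , p' , q' with strip q' r
... | _ , r' , s = _ , p' ◅ r' , s

church-rosser : ∀ {t u} → t ≃ u → ∃ λ s → t ⇒* s × u ⇒* s
church-rosser done = _ , done , done
church-rosser (fwd p ◅ e) with church-rosser e
... | s , q , r = s , p ◅ q , r
church-rosser (bwd p ◅ e) with church-rosser e
... | s , q , r with strip p q
... | s' , q' , p' = s' , q' , r ◅◅ (p' ◅ done)

≃-refl : ∀ {t} → t ≃ t
≃-refl = done

≃-reflexive : ∀ {t u} → t ≡ u → t ≃ u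
≃-reflexive refl = done

≃-sym : ∀ {t u} → t ≃ u → u ≃ t
≃-sym = symmetric _⇒_

≃-pi : ∀ {a U U' T T'} → U ≃ U' → T ≃ T' → pi° a U T ≃ pi° a U' T'
≃-pi {a} {U' = U'} {T} p q =
  ≃-gmap (λ U → pi° a U T) (λ r → ⇒-pi r (⇒-refl T)) p ◅◅ ≃-gmap (pi° a U') (⇒-pi (⇒-refl U')) q

≃-lam : ∀ {t t'} → t ≃ t' → lam° t ≃ lam° t'
≃-lam = ≃-gmap lam° ⇒-lam

≃-app : ∀ {t t' u u'} → t ≃ t' → u ≃ u' → app° t u ≃ app° t' u'
≃-app {t' = t'} {u} p q =
  ≃-gmap (λ t → app° t u) (λ r → ⇒-app r (⇒-refl u)) p ◅◅ ≃-gmap (app° t') (⇒-app (⇒-refl t')) q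

≃-β : ∀ t u → app° (lam° t) u ≃ t [ u ]°
≃-β t u = return (⇒-β (⇒-refl t) (⇒-refl u))

≃-η : ∀ t → lam° (app° (wk° t) (var° zero)) ≃ t
≃-η t = return (⇒-η (⇒-refl _))

≃-ren : ∀ {t t'} ρ → t ≃ t' → ren° ρ t ≃ ren° ρ t'
≃-ren ρ = ≃-gmap (ren° ρ) (⇒-ren ρ)

≃-sub : ∀ {t t'} σ → t ≃ t' → sub° σ t ≃ sub° σ t'
≃-sub σ = ≃-gmap (sub° σ) (⇒-sub (λ x → ⇒-refl (σ x)))

≃-[] : ∀ {t t' u u'} → t ≃ t' → u ≃ u' → t [ u ]° ≃ t' [ u' ]°
≃-[] {t' = t'} {u} p q = ≃-sub (single° u) p ◅◅ ≃-gmap (t' [_]°) (⇒-[] (⇒-refl t')) q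

-- Rigid heads and injectivity of function types.

data Neutral (x : ℕ) : Tm° → Set where
  neutral-var : Neutral x (var° x)
  neutral-app : ∀ {t u} → Neutral x t → Neutral x (app° t u)

-- Abstractions get no head: η can contract them to a term of any form, whereas the forms listed
-- here are stable under reduction.
data Head : Set where
  ⋆ʰ  : Head
  piʰ : Ann → Head
  neʰ : ℕ → Head

data HasHead : Head → Tm° → Set where
  head-⋆  : HasHead ⋆ʰ ⋆°
  head-pi : ∀ {a U T} → HasHead (piʰ a) (pi° a U T)
  head-ne : ∀ {x t} → Neutral x t → HasHead (neʰ x) t

neutral-⇒ : ∀ {x t s} → Neutral x t → t ⇒ s → Neutral x s
neutral-⇒ neutral-var ⇒-var = neutral-var
neutral-⇒ (neutral-app n) (⇒-app p q) = neutral-app (neutral-⇒ n p)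
neutral-⇒ (neutral-app ()) (⇒-β p q)

head-⇒* : ∀ {h t s} → HasHead h t → t ⇒* s → HasHead h s
head-⇒* h done = h
head-⇒* head-⋆ (⇒-⋆ ◅ p) = head-⇒* head-⋆ p
head-⇒* head-pi (⇒-pi _ _ ◅ p) = head-⇒* head-pi p
head-⇒* (head-ne n) (q ◅ p) = head-⇒* (head-ne (neutral-⇒ n q)) p

neutral-unique : ∀ {x y t} → Neutral x t → Neutral y t → x ≡ y
neutral-unique neutral-var neutral-var = refl
neutral-unique (neutral-app n) (neutral-app m) = neutral-unique n m

head-unique : ∀ {h h' t} → HasHead h t → HasHead h' t → h ≡ h'
head-unique head-⋆ head-⋆ = refl
head-unique head-pi head-pi = refl
head-unique (head-ne n) (head-ne m) = cong neʰ (neutral-unique n m)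
head-unique head-⋆ (head-ne ())
head-unique head-pi (head-ne ())
head-unique (head-ne ()) head-⋆
head-unique (head-ne ()) head-pi

≃-head : ∀ {h h' t t'} → HasHead h t → HasHead h' t' → t ≃ t' → h ≡ h'
≃-head h h' e with church-rosser e
... | s , p , q = head-unique (head-⇒* h p) (head-⇒* h' q)

pi-⇒* : ∀ {a U T s} → pi° a U T ⇒* s → ∃ λ U' → ∃ λ T' → s ≡ pi° a U' T' × U ≃ U' × T ≃ T'
pi-⇒* done = _ , _ , refl , done , done
pi-⇒* (⇒-pi p q ◅ r) with pi-⇒* r
... | _ , _ , refl , e , f = _ , _ , refl , fwd p ◅ e , fwd q ◅ f

≃-pi⁻¹ : ∀ {a a' U U' T T'} → pi° a U T ≃ pi° a' U' T' → a ≡ a' × U ≃ U' × T ≃ T'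
≃-pi⁻¹ e with church-rosser e
... | s , p , q with pi-⇒* p | pi-⇒* q
... | _ , _ , refl , e₁ , f₁ | _ , _ , refl , e₂ , f₂ = refl , e₁ ◅◅ ≃-sym e₂ , f₁ ◅◅ ≃-sym f₂

-- Head reduction and standardization.

data _→ʰ_ : Tm° → Tm° → Set where
  →ʰ-β   : ∀ {t u} → app° (lam° t) u →ʰ t [ u ]°
  →ʰ-app : ∀ {t t' u} → t →ʰ t' → app° t u →ʰ app° t' u

→ʰ-deterministic : ∀ {t s s'} → t →ʰ s → t →ʰ s' → s ≡ s'
→ʰ-deterministic →ʰ-β →ʰ-β = refl
→ʰ-deterministic (→ʰ-app p) (→ʰ-app q) = cong (λ t → app° t _) (→ʰ-deterministic p q)

→ʰ-ren : ∀ {t t'} ρ → t →ʰ t' → ren° ρ t →ʰ ren° ρ t'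
→ʰ-ren ρ (→ʰ-β {t} {u}) =
  subst (ren° ρ (app° (lam° t) u) →ʰ_) (sym (ren-single° ρ t u)) →ʰ-β
→ʰ-ren ρ (→ʰ-app p) = →ʰ-app (→ʰ-ren ρ p)

→ʰ-sub : ∀ {t t'} σ → t →ʰ t' → sub° σ t →ʰ sub° σ t'
→ʰ-sub σ (→ʰ-β {t} {u}) =
  subst (sub° σ (app° (lam° t) u) →ʰ_) (sym (sub-single° σ t u)) →ʰ-β
→ʰ-sub σ (→ʰ-app p) = →ʰ-app (→ʰ-sub σ p)

-- Standardised βη-reduction: β only as head steps, followed by reduction of the components.
data _⊳_ : Tm° → Tm° → Set where
  ⊳-⋆   : ⋆° ⊳ ⋆°
  ⊳-pi  : ∀ {a U U' T T'} → U ⊳ U' → T ⊳ T' → pi° a U T ⊳ pi° a U' T'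
  ⊳-var : ∀ {x} → var° x ⊳ var° x
  ⊳-lam : ∀ {t t'} → t ⊳ t' → lam° t ⊳ lam° t'
  ⊳-app : ∀ {t t' u u'} → t ⊳ t' → u ⊳ u' → app° t u ⊳ app° t' u'
  ⊳-η   : ∀ {t s} → t ⊳ app° (wk° s) (var° zero) → lam° t ⊳ s
  ⊳-h   : ∀ {t t' s} → t →ʰ t' → t' ⊳ s → t ⊳ s

⊳-refl : ∀ t → t ⊳ t
⊳-refl ⋆°          = ⊳-⋆
⊳-refl (pi° a U T) = ⊳-pi (⊳-refl U) (⊳-refl T)
⊳-refl (var° x)    = ⊳-var
⊳-refl (lam° t)    = ⊳-lam (⊳-refl t)
⊳-refl (app° t u)  = ⊳-app (⊳-refl t) (⊳-refl u)

⊳-ren : ∀ {t t'} ρ → t ⊳ t' → ren° ρ t ⊳ ren° ρ t'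
⊳-ren ρ ⊳-⋆         = ⊳-⋆
⊳-ren ρ (⊳-pi U T)  = ⊳-pi (⊳-ren ρ U) (⊳-ren (liftR ρ) T)
⊳-ren ρ ⊳-var       = ⊳-var
⊳-ren ρ (⊳-lam t)   = ⊳-lam (⊳-ren (liftR ρ) t)
⊳-ren ρ (⊳-app t u) = ⊳-app (⊳-ren ρ t) (⊳-ren ρ u)
⊳-ren ρ (⊳-η {s = s} t) =
  ⊳-η (subst (λ r → _ ⊳ app° r (var° zero)) (ren-wk° ρ s) (⊳-ren (liftR ρ) t))
⊳-ren ρ (⊳-h p t)   = ⊳-h (→ʰ-ren ρ p) (⊳-ren ρ t)

⊳-exts : ∀ {σ τ} → (∀ x → σ x ⊳ τ x) → ∀ x → exts° σ x ⊳ exts° τ x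
⊳-exts h zero    = ⊳-var
⊳-exts h (suc x) = ⊳-ren suc (h x)

⊳-sub : ∀ {t t' σ τ} → (∀ x → σ x ⊳ τ x) → t ⊳ t' → sub° σ t ⊳ sub° τ t'
⊳-sub h ⊳-⋆         = ⊳-⋆
⊳-sub h (⊳-pi U T)  = ⊳-pi (⊳-sub h U) (⊳-sub (⊳-exts h) T)
⊳-sub h ⊳-var       = h _
⊳-sub h (⊳-lam t)   = ⊳-lam (⊳-sub (⊳-exts h) t)
⊳-sub h (⊳-app t u) = ⊳-app (⊳-sub h t) (⊳-sub h u)
⊳-sub {τ = τ} h (⊳-η {s = s} t) =
  ⊳-η (subst (λ r → _ ⊳ app° r (var° zero)) (sub-wk° τ s) (⊳-sub (⊳-exts h) t))
⊳-sub {σ = σ} h (⊳-h p t) = ⊳-h (→ʰ-sub σ p) (⊳-sub h t)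

⊳-[] : ∀ {t t' u u'} → t ⊳ t' → u ⊳ u' → t [ u ]° ⊳ t' [ u' ]°
⊳-[] t u = ⊳-sub (λ { zero → u ; (suc x) → ⊳-var }) t

mutual
  ⊳-⇒ : ∀ {t s r} → t ⊳ s → s ⇒ r → t ⊳ r
  ⊳-⇒ ⊳-⋆ ⇒-⋆ = ⊳-⋆
  ⊳-⇒ (⊳-pi p q) (⇒-pi p' q') = ⊳-pi (⊳-⇒ p p') (⊳-⇒ q q')
  ⊳-⇒ ⊳-var ⇒-var = ⊳-var
  ⊳-⇒ (⊳-lam p) (⇒-lam q) = ⊳-lam (⊳-⇒ p q)
  ⊳-⇒ (⊳-lam p) (⇒-η q) = ⊳-η (⊳-⇒ p q)
  ⊳-⇒ (⊳-app p q) (⇒-app p' q') = ⊳-app (⊳-⇒ p p') (⊳-⇒ q q')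
  ⊳-⇒ (⊳-app p q) (⇒-β p' q') = ⊳-β p p' (⊳-⇒ q q')
  -- The step on the contractum is performed in the body, on its weakening, so η stays last. The
  -- step may grow; recursion is on the standard reduction alone.
  ⊳-⇒ (⊳-η p) q = ⊳-η (⊳-⇒ p (⇒-app (⇒-ren suc q) ⇒-var))
  ⊳-⇒ (⊳-h h p) q = ⊳-h h (⊳-⇒ p q)

  -- When the operator becomes an abstraction only by η, its body reduces to
  -- `app° (wk° (lam° b)) (var° zero)`, whose β-reduct is `b` again. The η-step is thereby absorbed,
  -- and the head β-step can come first.
  ⊳-β : ∀ {t b b' u u'} → t ⊳ lam° b → b ⇒ b' → u ⊳ u' → app° t u ⊳ b' [ u' ]°
  ⊳-β (⊳-lam p) q r = ⊳-h →ʰ-β (⊳-[] (⊳-⇒ p q) r)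
  ⊳-β {b' = b'} (⊳-η p) q r = ⊳-h →ʰ-β (⊳-[] (subst (_ ⊳_) (lift-wk-single-zero° b')
    (⊳-⇒ p (⇒-β (⇒-ren (liftR suc) q) ⇒-var))) r)
  ⊳-β (⊳-h h p) q r = ⊳-h (→ʰ-app h) (⊳-β p q r)

⊳-⇒* : ∀ {t s r} → t ⊳ s → s ⇒* r → t ⊳ r
⊳-⇒* p done    = p
⊳-⇒* p (q ◅ r) = ⊳-⇒* (⊳-⇒ p q) r

-- Head normalization of terms convertible to rigid ones.

data Whnf° : Tm° → Set where
  whnf-⋆   : Whnf° ⋆°
  whnf-pi  : ∀ {a U T} → Whnf° (pi° a U T)
  whnf-lam : ∀ {t} → Whnf° (lam° t)
  whnf-ne  : ∀ {x t} → Neutral x t → Whnf° t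

data HeadNormalizing : Tm° → Set where
  hn-whnf : ∀ {t} → Whnf° t → HeadNormalizing t
  hn-step : ∀ {t t'} → t →ʰ t' → HeadNormalizing t' → HeadNormalizing t

neutral-↛ʰ : ∀ {x t s} → Neutral x t → t →ʰ s → ⊥
neutral-↛ʰ (neutral-app ()) →ʰ-β
neutral-↛ʰ (neutral-app n) (→ʰ-app p) = neutral-↛ʰ n p

whnf-↛ʰ : ∀ {t s} → Whnf° t → t →ʰ s → ⊥
whnf-↛ʰ (whnf-ne n) p = neutral-↛ʰ n p

-- Unlike head normalization, this is closed under application to further arguments, which is what
-- a neutral reduct produced by η-contractions under application requires.
data Solvable (x : ℕ) : Tm° → Set where
  solvable-ne   : ∀ {t} → Neutral x t → Solvable x t
  solvable-lam  : ∀ {t} → Solvable (suc x) t → Solvable x (lam° t)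
  solvable-step : ∀ {t t'} → t →ʰ t' → Solvable x t' → Solvable x t

neutral-ren : ∀ {x t} ρ → Neutral x t → Neutral (ρ x) (ren° ρ t)
neutral-ren ρ neutral-var     = neutral-var
neutral-ren ρ (neutral-app n) = neutral-app (neutral-ren ρ n)

neutral-sub : ∀ {x y t} σ → σ x ≡ var° y → Neutral x t → Neutral y (sub° σ t)
neutral-sub σ e neutral-var rewrite e = neutral-var
neutral-sub σ e (neutral-app n)       = neutral-app (neutral-sub σ e n)

solvable-sub : ∀ {x y t} σ → σ x ≡ var° y → Solvable x t → Solvable y (sub° σ t)
solvable-sub σ e (solvable-ne n)     = solvable-ne (neutral-sub σ e n)
solvable-sub σ e (solvable-lam s)    = solvable-lam (solvable-sub (exts° σ) (cong wk° e) s)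
solvable-sub σ e (solvable-step p s) = solvable-step (→ʰ-sub σ p) (solvable-sub σ e s)

solvable-app : ∀ {x t} u → Solvable x t → Solvable x (app° t u)
solvable-app u (solvable-ne n)     = solvable-ne (neutral-app n)
-- The head variable of the body is `suc x`, not the bound variable, so instantiating the latter
-- leaves the head a variable.
solvable-app u (solvable-lam s)    = solvable-step →ʰ-β (solvable-sub (single° u) refl s)
solvable-app u (solvable-step p s) = solvable-step (→ʰ-app p) (solvable-app u s)

⊳-neutral : ∀ {x t n} → t ⊳ n → Neutral x n → Solvable x t
⊳-neutral ⊳-var neutral-var         = solvable-ne neutral-var
⊳-neutral (⊳-app p _) (neutral-app n) = solvable-app _ (⊳-neutral p n)
⊳-neutral (⊳-η p) n                 = solvable-lam (⊳-neutral p (neutral-app (neutral-ren suc n)))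
⊳-neutral (⊳-h h p) n               = solvable-step h (⊳-neutral p n)

solvable-headNormalizing : ∀ {x t} → Solvable x t → HeadNormalizing t
solvable-headNormalizing (solvable-ne n)     = hn-whnf (whnf-ne n)
solvable-headNormalizing (solvable-lam _)    = hn-whnf whnf-lam
solvable-headNormalizing (solvable-step p s) = hn-step p (solvable-headNormalizing s)

⊳-headNormalizing : ∀ {h t s} → t ⊳ s → HasHead h s → HeadNormalizing t
⊳-headNormalizing p (head-ne n)        = solvable-headNormalizing (⊳-neutral p n)
⊳-headNormalizing ⊳-⋆ head-⋆           = hn-whnf whnf-⋆
⊳-headNormalizing (⊳-pi _ _) head-pi   = hn-whnf whnf-pi
⊳-headNormalizing (⊳-η _) _            = hn-whnf whnf-lam
⊳-headNormalizing (⊳-h q p) h          = hn-step q (⊳-headNormalizing p h)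

≃-headNormalizing : ∀ {h t s} → t ≃ s → HasHead h s → HeadNormalizing t
≃-headNormalizing {t = t} e h with church-rosser e
... | _ , p , q = ⊳-headNormalizing (⊳-⇒* (⊳-refl t) p) (head-⇒* h q)

⋆≄pi : ∀ {a U T} → ⋆° ≃ pi° a U T → ⊥
⋆≄pi e with ≃-head head-⋆ head-pi e
... | ()

-- Erasure and coarse typing.

infix 4 _⊩_∶_ _↦_ _↦*_

-- Irrelevant β and η become identities; ⋆° is a dummy for the variable of an irrelevant
-- abstraction, which does not occur in the erasure of a typed body.
er : Tm → Tm°
er (sort k)       = ⋆°
er (pi a i j U T) = pi° a (er U) (er T)
er (var x)        = var° x
er (lam rel U t)  = lam° (er t)
er (lam irr U t)  = er t [ ⋆° ]°
er (app rel t u)  = app° (er t) (er u)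
er (app irr t u)  = er t

er-ren : ∀ ρ t → er (ren ρ t) ≡ ren° ρ (er t)
er-ren ρ (sort k)       = refl
er-ren ρ (pi a i j U T) = cong₂ (pi° a) (er-ren ρ U) (er-ren (liftR ρ) T)
er-ren ρ (var x)        = refl
er-ren ρ (lam rel U t)  = cong lam° (er-ren (liftR ρ) t)
er-ren ρ (lam irr U t)  =
  trans (cong (_[ ⋆° ]°) (er-ren (liftR ρ) t)) (sym (ren-single° ρ (er t) ⋆°))
er-ren ρ (app rel t u)  = cong₂ app° (er-ren ρ t) (er-ren ρ u)
er-ren ρ (app irr t u)  = er-ren ρ t

er-exts : ∀ {σ τ} → (∀ x → er (σ x) ≡ τ x) → ∀ x → er (exts σ x) ≡ exts° τ x
er-exts h zero    = refl
er-exts {σ} h (suc x) = trans (er-ren suc (σ x)) (cong wk° (h x))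

er-sub : ∀ {σ τ} → (∀ x → er (σ x) ≡ τ x) → ∀ t → er (sub σ t) ≡ sub° τ (er t)
er-sub h (sort k)       = refl
er-sub h (pi a i j U T) = cong₂ (pi° a) (er-sub h U) (er-sub (er-exts h) T)
er-sub h (var x)        = h x
er-sub h (lam rel U t)  = cong lam° (er-sub (er-exts h) t)
er-sub {τ = τ} h (lam irr U t) =
  trans (cong (_[ ⋆° ]°) (er-sub (er-exts h) t)) (sym (sub-single° τ (er t) ⋆°))
er-sub h (app rel t u)  = cong₂ app° (er-sub h t) (er-sub h u)
er-sub h (app irr t u)  = er-sub h t

er-[] : ∀ t u → er (t [ u ]) ≡ er t [ er u ]°
er-[] t u = er-sub (λ { zero → refl ; (suc x) → refl }) t

-- A coarsening of typing: conversion is untyped, universe levels are forgotten and irrelevant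
-- arguments are unconstrained. Injectivity of function types, hence inversion and subject
-- reduction, then come from confluence.
data _⊩_∶_ (Γ : Ctx) : Tm → Tm° → Set where
  ⊩-sort : ∀ {k} → Γ ⊩ sort k ∶ ⋆°
  ⊩-pi   : ∀ {a i j U T} → Γ ⊩ U ∶ ⋆° → Γ ▸ (a , U) ⊩ T ∶ ⋆° → Γ ⊩ pi a i j U T ∶ ⋆°
  ⊩-var  : ∀ {x U} → Γ ∋ x ∶ U → Γ ⊩ var x ∶ er U
  ⊩-lam  : ∀ {a U t X} → Γ ▸ (a , U) ⊩ t ∶ X → Γ ⊩ lam a U t ∶ pi° a (er U) X
  ⊩-app  : ∀ {t u X Y} → Γ ⊩ t ∶ pi° rel X Y → Γ ⊩ u ∶ X → Γ ⊩ app rel t u ∶ Y [ er u ]°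
  ⊩-iapp : ∀ {t u X Y} → Γ ⊩ t ∶ pi° irr X Y → Γ ⊩ app irr t u ∶ Y [ er u ]°
  ⊩-conv : ∀ {t X Y} → Γ ⊩ t ∶ X → X ≃ Y → Γ ⊩ t ∶ Y

IsType : Ctx → Tm → Set
IsType Γ T = Γ ⊩ T ∶ ⋆°

⊩-cast : ∀ {Γ t X Y} → Γ ⊩ t ∶ X → X ≡ Y → Γ ⊩ t ∶ Y
⊩-cast p refl = p

pi-inversion : ∀ {Γ a i j U T X} → Γ ⊩ pi a i j U T ∶ X → IsType Γ U × IsType (Γ ▸ (a , U)) T
pi-inversion (⊩-pi p q)   = p , q
pi-inversion (⊩-conv p _) = pi-inversion p

lam-inversion : ∀ {Γ a U t X} → Γ ⊩ lam a U t ∶ X →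
                ∃ λ Y → Γ ▸ (a , U) ⊩ t ∶ Y × pi° a (er U) Y ≃ X
lam-inversion (⊩-lam p) = _ , p , ≃-refl
lam-inversion (⊩-conv p e) with lam-inversion p
... | Y , q , f = Y , q , f ◅◅ e

var-inversion : ∀ {Γ x X} → Γ ⊩ var x ∶ X → ∃ λ U → Γ ∋ x ∶ U × er U ≃ X
var-inversion (⊩-var x) = _ , x , ≃-refl
var-inversion (⊩-conv p e) with var-inversion p
... | U , q , f = U , q , f ◅◅ e

app-inversion : ∀ {Γ a t u X} → Γ ⊩ app a t u ∶ X →
                ∃ λ Y → ∃ λ Z → Γ ⊩ t ∶ pi° a Y Z × (a ≡ rel → Γ ⊩ u ∶ Y) × Z [ er u ]° ≃ X
app-inversion (⊩-app p q) = _ , _ , p , (λ _ → q) , ≃-refl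
app-inversion (⊩-iapp p)  = _ , _ , p , (λ ()) , ≃-refl
app-inversion (⊩-conv p e) with app-inversion p
... | _ , _ , q , r , f = _ , _ , q , r , f ◅◅ e

sort-inversion : ∀ {Γ k X} → Γ ⊩ sort k ∶ X → ⋆° ≃ X
sort-inversion ⊩-sort       = ≃-refl
sort-inversion (⊩-conv p e) = sort-inversion p ◅◅ e

pi-type : ∀ {Γ a i j U T X} → Γ ⊩ pi a i j U T ∶ X → ⋆° ≃ X
pi-type (⊩-pi _ _)   = ≃-refl
pi-type (⊩-conv p e) = pi-type p ◅◅ e

∋-unique : ∀ {Γ x T T'} → Γ ∋ x ∶ T → Γ ∋ x ∶ T' → T ≡ T'
∋-unique here here = refl
∋-unique (there p) (there q) = cong wk (∋-unique p q)

⊩-unique : ∀ {Γ t X Y} → Γ ⊩ t ∶ X → Γ ⊩ t ∶ Y → X ≃ Y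
⊩-unique (⊩-conv p e) q = ≃-sym e ◅◅ ⊩-unique p q
⊩-unique ⊩-sort q = sort-inversion q
⊩-unique (⊩-pi _ _) q = pi-type q
⊩-unique (⊩-var x) q with var-inversion q
... | U , y , e = ≃-reflexive (cong er (∋-unique x y)) ◅◅ e
⊩-unique (⊩-lam p) q with lam-inversion q
... | Y , r , e = ≃-pi ≃-refl (⊩-unique p r) ◅◅ e
⊩-unique (⊩-app p _) q with app-inversion q
... | _ , _ , r , _ , e = ≃-[] (proj₂ (proj₂ (≃-pi⁻¹ (⊩-unique p r)))) ≃-refl ◅◅ e
⊩-unique (⊩-iapp p) q with app-inversion q
... | _ , _ , r , _ , e = ≃-[] (proj₂ (proj₂ (≃-pi⁻¹ (⊩-unique p r)))) ≃-refl ◅◅ e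

-- Renaming, substitution and context conversion for coarse typing.

RenTyped : (ℕ → ℕ) → Ctx → Ctx → Set
RenTyped ρ Γ Δ = ∀ {x T} → Γ ∋ x ∶ T → Δ ⊩ var (ρ x) ∶ ren° ρ (er T)

renTyped-lift : ∀ {ρ Γ Δ a U} → RenTyped ρ Γ Δ →
                RenTyped (liftR ρ) (Γ ▸ (a , U)) (Δ ▸ (a , ren ρ U))
renTyped-lift {ρ} {U = U} h here = ⊩-cast (⊩-var here) eq
  where
  eq : er (wk (ren ρ U)) ≡ ren° (liftR ρ) (er (wk U))
  eq = trans (er-ren suc (ren ρ U)) (trans (cong wk° (er-ren ρ U))
    (trans (sym (ren-wk° ρ (er U))) (cong (ren° (liftR ρ)) (sym (er-ren suc U)))))
renTyped-lift {ρ} h (there {T = T} x)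
  with var-inversion (h x)
... | V , q , e = ⊩-conv (⊩-var (there q)) (subst₂ _≃_ (sym (er-ren suc V)) eq (≃-ren suc e))
  where
  eq : wk° (ren° ρ (er T)) ≡ ren° (liftR ρ) (er (wk T))
  eq = trans (sym (ren-wk° ρ (er T))) (cong (ren° (liftR ρ)) (sym (er-ren suc T)))

⊩-ren : ∀ {ρ Γ Δ t X} → RenTyped ρ Γ Δ → Γ ⊩ t ∶ X → Δ ⊩ ren ρ t ∶ ren° ρ X
⊩-ren h ⊩-sort      = ⊩-sort
⊩-ren h (⊩-pi p q)  = ⊩-pi (⊩-ren h p) (⊩-ren (renTyped-lift h) q)
⊩-ren h (⊩-var x)   = h x
⊩-ren {ρ} h (⊩-lam {U = U} p) =
  ⊩-cast (⊩-lam (⊩-ren (renTyped-lift h) p)) (cong (λ V → pi° _ V _) (er-ren ρ U))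
⊩-ren {ρ} h (⊩-app {u = u} {Y = Y} p q) = ⊩-cast (⊩-app (⊩-ren h p) (⊩-ren h q))
  (trans (cong (ren° (liftR ρ) Y [_]°) (er-ren ρ u)) (sym (ren-single° ρ Y (er u))))
⊩-ren {ρ} h (⊩-iapp {u = u} {Y = Y} p) = ⊩-cast (⊩-iapp (⊩-ren h p))
  (trans (cong (ren° (liftR ρ) Y [_]°) (er-ren ρ u)) (sym (ren-single° ρ Y (er u))))
⊩-ren {ρ} h (⊩-conv p e) = ⊩-conv (⊩-ren h p) (≃-ren ρ e)

⊩-wk : ∀ {Γ B t X} → Γ ⊩ t ∶ X → (Γ ▸ B) ⊩ wk t ∶ wk° X
⊩-wk = ⊩-ren (λ {x} {T} p → ⊩-cast (⊩-var (there p)) (er-ren suc T))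

-- `σ°` is kept apart from `λ x → er (σ x)` because under a binder `er (exts σ x)` and `exts° σ° x`
-- agree only pointwise.
record SubTyped (σ : ℕ → Tm) (σ° : ℕ → Tm°) (Γ Δ : Ctx) : Set where
  field
    erases : ∀ x → er (σ x) ≡ σ° x
    typed  : ∀ {x T} → Γ ∋ x ∶ T → Δ ⊩ σ x ∶ sub° σ° (er T)
open SubTyped

subTyped-exts : ∀ {σ σ° Γ Δ a U} → SubTyped σ σ° Γ Δ →
                SubTyped (exts σ) (exts° σ°) (Γ ▸ (a , U)) (Δ ▸ (a , sub σ U))
subTyped-exts {σ} {σ°} {Γ} {Δ} {a} {U} h = record { erases = er-exts (erases h) ; typed = go }
  where
  wk-sub : ∀ T → wk° (sub° σ° (er T)) ≡ sub° (exts° σ°) (er (wk T))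
  wk-sub T = trans (sym (sub-wk° σ° (er T))) (cong (sub° (exts° σ°)) (sym (er-ren suc T)))
  go : ∀ {x T} → (Γ ▸ (a , U)) ∋ x ∶ T → Δ ▸ (a , sub σ U) ⊩ exts σ x ∶ sub° (exts° σ°) (er T)
  go here = ⊩-cast (⊩-var here)
    (trans (er-ren suc (sub σ U)) (trans (cong wk° (er-sub (erases h) U)) (wk-sub U)))
  go (there {T = T} x) = ⊩-cast (⊩-wk (typed h x)) (wk-sub T)

⊩-sub : ∀ {σ σ° Γ Δ t X} → SubTyped σ σ° Γ Δ → Γ ⊩ t ∶ X → Δ ⊩ sub σ t ∶ sub° σ° X
⊩-sub h ⊩-sort      = ⊩-sort
⊩-sub h (⊩-pi p q)  = ⊩-pi (⊩-sub h p) (⊩-sub (subTyped-exts h) q)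
⊩-sub h (⊩-var x)   = typed h x
⊩-sub h (⊩-lam {U = U} p) =
  ⊩-cast (⊩-lam (⊩-sub (subTyped-exts h) p)) (cong (λ V → pi° _ V _) (er-sub (erases h) U))
⊩-sub {σ° = σ°} h (⊩-app {u = u} {Y = Y} p q) = ⊩-cast (⊩-app (⊩-sub h p) (⊩-sub h q))
  (trans (cong (sub° (exts° σ°) Y [_]°) (er-sub (erases h) u)) (sym (sub-single° σ° Y (er u))))
⊩-sub {σ° = σ°} h (⊩-iapp {u = u} {Y = Y} p) = ⊩-cast (⊩-iapp (⊩-sub h p))
  (trans (cong (sub° (exts° σ°) Y [_]°) (er-sub (erases h) u)) (sym (sub-single° σ° Y (er u))))
⊩-sub {σ° = σ°} h (⊩-conv p e) = ⊩-conv (⊩-sub h p) (≃-sub σ° e)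

-- The condition `a ≡ rel` matches `here`, which exists for relevant entries only: the argument is
-- looked up exactly in that case.
⊩-[] : ∀ {Γ a U t u X} → Γ ▸ (a , U) ⊩ t ∶ X → (a ≡ rel → Γ ⊩ u ∶ er U) →
       Γ ⊩ t [ u ] ∶ X [ er u ]°
⊩-[] {Γ} {a} {U} {t} {u} p q = ⊩-sub (record { erases = single-erases ; typed = go }) p
  where
  single-erases : ∀ x → er (single u x) ≡ single° (er u) x
  single-erases zero    = refl
  single-erases (suc x) = refl
  wk-er-single : ∀ T → er T ≡ er (wk T) [ er u ]°
  wk-er-single T = sym (trans (cong (_[ er u ]°) (er-ren suc T)) (wk-single° (er u) (er T)))
  go : ∀ {x T} → (Γ ▸ (a , U)) ∋ x ∶ T → Γ ⊩ single u x ∶ er T [ er u ]°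
  go here              = ⊩-cast (q refl) (wk-er-single U)
  go (there {T = T} x) = ⊩-cast (⊩-var x) (wk-er-single T)

infix 4 _≋_
_≋_ : Ctx → Ctx → Set
Γ ≋ Δ = ∀ {x T} → Γ ∋ x ∶ T → ∃ λ T' → Δ ∋ x ∶ T' × er T ≃ er T'

≋-refl : ∀ {Γ} → Γ ≋ Γ
≋-refl x = _ , x , ≃-refl

≃-wk : ∀ T T' → er T ≃ er T' → er (wk T) ≃ er (wk T')
≃-wk T T' e = subst₂ _≃_ (sym (er-ren suc T)) (sym (er-ren suc T')) (≃-ren suc e)

≋-extend : ∀ {Γ Δ a U V} → Γ ≋ Δ → er U ≃ er V → (Γ ▸ (a , U)) ≋ (Δ ▸ (a , V))
≋-extend {U = U} {V} h e here = _ , here , ≃-wk U V e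
≋-extend h e (there {T = T} x) with h x
... | T' , y , f = _ , there y , ≃-wk T T' f

⊩-≋ : ∀ {Γ Δ t X} → Γ ≋ Δ → Γ ⊩ t ∶ X → Δ ⊩ t ∶ X
⊩-≋ h ⊩-sort       = ⊩-sort
⊩-≋ h (⊩-pi p q)   = ⊩-pi (⊩-≋ h p) (⊩-≋ (≋-extend h ≃-refl) q)
⊩-≋ h (⊩-var x) with h x
... | T' , y , e = ⊩-conv (⊩-var y) (≃-sym e)
⊩-≋ h (⊩-lam p)    = ⊩-lam (⊩-≋ (≋-extend h ≃-refl) p)
⊩-≋ h (⊩-app p q)  = ⊩-app (⊩-≋ h p) (⊩-≋ h q)
⊩-≋ h (⊩-iapp p)   = ⊩-iapp (⊩-≋ h p)
⊩-≋ h (⊩-conv p e) = ⊩-conv (⊩-≋ h p) e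

exts°-agree : ∀ {Γ a U σ τ} → (∀ {x T} → Γ ∋ x ∶ T → σ x ≡ τ x) →
              ∀ {x T} → (Γ ▸ (a , U)) ∋ x ∶ T → exts° σ x ≡ exts° τ x
exts°-agree h here      = refl
exts°-agree h (there x) = cong wk° (h x)

-- Γ ∋ x ∶ T holds for relevant x only: no irrelevant variable survives in the erasure of a typed
-- term.
er-irrelevance : ∀ {Γ t X σ τ} → Γ ⊩ t ∶ X → (∀ {x T} → Γ ∋ x ∶ T → σ x ≡ τ x) →
                 sub° σ (er t) ≡ sub° τ (er t)
er-irrelevance ⊩-sort h        = refl
er-irrelevance (⊩-pi p q) h    =
  cong₂ (pi° _) (er-irrelevance p h) (er-irrelevance q (exts°-agree h))
er-irrelevance (⊩-var x) h     = h x
er-irrelevance (⊩-lam {rel} p) h = cong lam° (er-irrelevance p (exts°-agree h))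
er-irrelevance {σ = σ} {τ} (⊩-lam {irr} {t = t} p) h = trans (sub-single° σ (er t) ⋆°)
  (trans (cong (_[ ⋆° ]°) (er-irrelevance p (exts°-agree h))) (sym (sub-single° τ (er t) ⋆°)))
er-irrelevance (⊩-app p q) h   = cong₂ app° (er-irrelevance p h) (er-irrelevance q h)
er-irrelevance (⊩-iapp p) h    = er-irrelevance p h
er-irrelevance (⊩-conv p _) h  = er-irrelevance p h

-- The algorithm does not compare irrelevant arguments; this is why the result types `T [ u ]` and
-- `T [ u' ]` of two irrelevant applications still agree after erasure.
er-irr-[] : ∀ {Γ U t X} u v → Γ ▸ (irr , U) ⊩ t ∶ X → er t [ u ]° ≡ er t [ v ]°
er-irr-[] u v p = er-irrelevance p (λ { (there x) → refl })

er-β-irr : ∀ {Γ U t X} u → Γ ▸ (irr , U) ⊩ t ∶ X → er t [ ⋆° ]° ≡ er (t [ u ])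
er-β-irr {t = t} u p = trans (er-irr-[] ⋆° (er u) p) (sym (er-[] t u))

er-η-irr : ∀ {U u} t → er (lam irr U (app irr (wk t) u)) ≡ er t
er-η-irr t = trans (cong (_[ ⋆° ]°) (er-ren suc t)) (wk-single° ⋆° (er t))

-- From judgmental to untyped equality.

mutual
  -- Mutual with `⊢⇒≃`: the conversion rule needs equal types to be convertible, and irrelevant β is
  -- an identity on erasures only when the body is typed.
  ⊢⇒⊩ : ∀ {Γ t T} → Γ ⊢ t ∶ T → Γ ⊩ t ∶ er T
  ⊢⇒⊩ (ty-sort _)   = ⊩-sort
  ⊢⇒⊩ (ty-pi p q)   = ⊩-pi (⊢⇒⊩ p) (⊢⇒⊩ q)
  ⊢⇒⊩ (ty-var _ x)  = ⊩-var x
  ⊢⇒⊩ (ty-lam p _)  = ⊩-lam (⊢⇒⊩ p)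
  ⊢⇒⊩ (ty-app {a = rel} {T = T} {u = u} p q) = ⊩-cast (⊩-app (⊢⇒⊩ p) (⊢⇒⊩ q)) (sym (er-[] T u))
  ⊢⇒⊩ (ty-app {a = irr} {T = T} {u = u} p q) = ⊩-cast (⊩-iapp (⊢⇒⊩ p)) (sym (er-[] T u))
  ⊢⇒⊩ (ty-conv p e) = ⊩-conv (⊢⇒⊩ p) (⊢⇒≃ e)

  ⊢⇒≃ : ∀ {Γ t u T} → _⊢_≡_∶_ Γ t u T → er t ≃ er u
  ⊢⇒≃ (eq-β {a = rel} {t = t} {u} _ _) = ≃-β (er t) (er u) ◅◅ ≃-reflexive (sym (er-[] t u))
  ⊢⇒≃ (eq-β {a = irr} {u = u} p _)     = ≃-reflexive (er-β-irr u (⊢⇒⊩ p))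
  ⊢⇒≃ (eq-η {a = rel} {t = t} _)       =
    ≃-sym (≃-reflexive (cong (λ s → lam° (app° s _)) (er-ren suc t)) ◅◅ ≃-η (er t))
  ⊢⇒≃ (eq-η {a = irr} {U = U} {t = t} _) = ≃-reflexive (sym (er-η-irr {U} {var zero} t))
  ⊢⇒≃ (eq-refl _)       = ≃-refl
  ⊢⇒≃ (eq-sym e)        = ≃-sym (⊢⇒≃ e)
  ⊢⇒≃ (eq-trans e f)    = ⊢⇒≃ e ◅◅ ⊢⇒≃ f
  ⊢⇒≃ (eq-pi e f)       = ≃-pi (⊢⇒≃ e) (⊢⇒≃ f)
  ⊢⇒≃ (eq-lam {a = rel} _ _ e) = ≃-lam (⊢⇒≃ e)
  ⊢⇒≃ (eq-lam {a = irr} _ _ e) = ≃-sub _ (⊢⇒≃ e)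
  ⊢⇒≃ (eq-app {a = rel} e f)   = ≃-app (⊢⇒≃ e) (⊢⇒≃ f)
  ⊢⇒≃ (eq-app {a = irr} e _)   = ⊢⇒≃ e
  ⊢⇒≃ (eq-conv e _)     = ⊢⇒≃ e

-- Weak head evaluation of typed terms.

data _↦_ : Tm → Tm → Set where
  ↦-β   : ∀ {a U t u} → app a (lam a U t) u ↦ t [ u ]
  ↦-app : ∀ {a t t' u} → t ↦ t' → app a t u ↦ app a t' u

_↦*_ : Tm → Tm → Set
_↦*_ = Star _↦_

mutual
  ↘⇒↦* : ∀ {t r} → t ↘ r → t ↦* r
  ↘⇒↦* (ev-whnf _)            = done
  ↘⇒↦* (ev-app {s} {u = u} p q) = gmap (λ t → app s t u) ↦-app (↘⇒↦* p) ◅◅ ·↘⇒↦* q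

  ·↘⇒↦* : ∀ {a f u r} → f ·[ a ] u ↘ r → app a f u ↦* r
  ·↘⇒↦* (ev-β p)  = ↦-β ◅ ↘⇒↦* p
  ·↘⇒↦* (ev-ne _) = done

↘-whnf : ∀ {t r} → t ↘ r → Whnf r
↘-whnf (ev-whnf w)           = w
↘-whnf (ev-app _ (ev-β p))   = ↘-whnf p
↘-whnf (ev-app _ (ev-ne n))  = wh-ne (ne-app n)

ne-↘ : ∀ {n r} → Ne n → n ↘ r → n ≡ r
ne-↘ _ (ev-whnf _) = refl
ne-↘ (ne-app n) (ev-app p q) with ne-↘ n p
ne-↘ (ne-app n) (ev-app p (ev-ne _)) | refl = refl
ne-↘ (ne-app ()) (ev-app p (ev-β _)) | refl

↘-deterministic : ∀ {t r r'} → t ↘ r → t ↘ r' → r ≡ r'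
↘-deterministic (ev-whnf _) (ev-whnf _) = refl
↘-deterministic (ev-whnf (wh-ne n)) q@(ev-app _ _) = ne-↘ n q
↘-deterministic p@(ev-app _ _) (ev-whnf (wh-ne n)) = sym (ne-↘ n p)
↘-deterministic (ev-app p q) (ev-app p' q') with ↘-deterministic p p'
↘-deterministic (ev-app p (ev-β q)) (ev-app p' (ev-β q')) | refl = ↘-deterministic q q'
↘-deterministic (ev-app p (ev-ne _)) (ev-app p' (ev-ne _)) | refl = refl
↘-deterministic (ev-app p (ev-β q)) (ev-app p' (ev-ne ())) | refl
↘-deterministic (ev-app p (ev-ne ())) (ev-app p' (ev-β _)) | refl

↦-↘ : ∀ {t t' r} → t ↦ t' → t' ↘ r → t ↘ r
↦-↘ ↦-β q = ev-app (ev-whnf wh-lam) (ev-β q)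
↦-↘ (↦-app p) (ev-app q s) = ev-app (↦-↘ p q) s
↦-↘ (↦-app p) (ev-whnf (wh-ne (ne-app n))) = ev-app (↦-↘ p (ev-whnf (wh-ne n))) (ev-ne n)

β-inversion : ∀ {Γ a b U t u X} → Γ ⊩ app a (lam b U t) u ∶ X →
              a ≡ b × ∃ λ Y → Γ ▸ (a , U) ⊩ t ∶ Y × (a ≡ rel → Γ ⊩ u ∶ er U) × Y [ er u ]° ≃ X
β-inversion p with app-inversion p
... | _ , _ , q , r , e with lam-inversion q
... | Y , s , f with ≃-pi⁻¹ f
... | refl , g , h =
  refl , Y , s , (λ eq → ⊩-conv (r eq) (≃-sym g)) , ≃-[] h ≃-refl ◅◅ e

↦-er : ∀ {Γ t t' X} → Γ ⊩ t ∶ X → t ↦ t' → er t ≃ er t'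
↦-er p (↦-β {rel} {t = t} {u}) = ≃-β (er t) (er u) ◅◅ ≃-reflexive (sym (er-[] t u))
↦-er p (↦-β {irr} {u = u}) with β-inversion p
... | refl , _ , q , _ = ≃-reflexive (er-β-irr u q)
↦-er p (↦-app {rel} s) with app-inversion p
... | _ , _ , q , _ = ≃-app (↦-er q s) ≃-refl
↦-er p (↦-app {irr} s) with app-inversion p
... | _ , _ , q , _ = ↦-er q s

subject-reduction : ∀ {Γ t t' X} → Γ ⊩ t ∶ X → t ↦ t' → Γ ⊩ t' ∶ X
subject-reduction p ↦-β with β-inversion p
... | refl , _ , q , r , e = ⊩-conv (⊩-[] q r) e
subject-reduction (⊩-app p q) (↦-app s)  = ⊩-app (subject-reduction p s) q
subject-reduction (⊩-iapp p) (↦-app s)   = ⊩-iapp (subject-reduction p s)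
subject-reduction (⊩-conv p e) s@(↦-app _) = ⊩-conv (subject-reduction p s) e

↦*-sound : ∀ {Γ t t' X} → Γ ⊩ t ∶ X → t ↦* t' → Γ ⊩ t' ∶ X × er t ≃ er t'
↦*-sound p done = p , ≃-refl
↦*-sound p (s ◅ r) with ↦*-sound (subject-reduction p s) r
... | q , e = q , ↦-er p s ◅◅ e

↘-sound : ∀ {Γ t r X} → Γ ⊩ t ∶ X → t ↘ r → Γ ⊩ r ∶ X × er t ≃ er r
↘-sound p e = ↦*-sound p (↘⇒↦* e)

progress : ∀ {Γ t X} → Γ ⊩ t ∶ X → Whnf t ⊎ ∃ (t ↦_)
progress {t = sort _} p       = inj₁ wh-sort
progress {t = pi _ _ _ _ _} p = inj₁ wh-pi
progress {t = var _} p        = inj₁ (wh-ne ne-var)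
progress {t = lam _ _ _} p    = inj₁ wh-lam
progress {t = app _ _ _} p with app-inversion p
... | _ , _ , q , _ with progress q
... | inj₂ (_ , s)       = inj₂ (_ , ↦-app s)
... | inj₁ (wh-ne n)     = inj₁ (wh-ne (ne-app n))
... | inj₁ wh-lam with β-inversion p
... | refl , _           = inj₂ (_ , ↦-β)
progress {t = app _ _ _} p | _ , _ , q , _ | inj₁ wh-sort =
  ⊥-elim (⋆≄pi (sort-inversion q))
progress {t = app _ _ _} p | _ , _ , q , _ | inj₁ wh-pi =
  ⊥-elim (⋆≄pi (pi-type q))

-- Bounds the number of consecutive irrelevant head β-steps; these are invisible after erasure.
irrSize : Tm → ℕ
irrSize (app a t u)   = suc (irrSize t)
irrSize (lam irr U t) = suc (irrSize t)
irrSize _             = zero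

irrSize-ren : ∀ ρ t → irrSize (ren ρ t) ≡ irrSize t
irrSize-ren ρ (sort k)       = refl
irrSize-ren ρ (pi a i j U T) = refl
irrSize-ren ρ (var x)        = refl
irrSize-ren ρ (lam rel U t)  = refl
irrSize-ren ρ (lam irr U t)  = cong suc (irrSize-ren (liftR ρ) t)
irrSize-ren ρ (app a t u)    = cong suc (irrSize-ren ρ t)

-- Only relevant variables are looked up. Instantiating an irrelevant one sends all of these to
-- variables, so the inserted argument adds nothing to the measure.
irrSize-sub : ∀ {Γ t X σ} → Γ ⊩ t ∶ X → (∀ {x T} → Γ ∋ x ∶ T → irrSize (σ x) ≡ 0) →
              irrSize (sub σ t) ≡ irrSize t
irrSize-sub ⊩-sort h       = refl
irrSize-sub (⊩-pi p q) h   = refl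
irrSize-sub (⊩-var x) h    = h x
irrSize-sub (⊩-lam {rel} p) h = refl
irrSize-sub {σ = σ} (⊩-lam {irr} p) h = cong suc (irrSize-sub p
  (λ { (there {x = x} y) → trans (irrSize-ren suc (σ x)) (h y) }))
irrSize-sub (⊩-app p q) h  = cong suc (irrSize-sub p h)
irrSize-sub (⊩-iapp p) h   = cong suc (irrSize-sub p h)
irrSize-sub (⊩-conv p _) h = irrSize-sub p h

↦-er-step : ∀ {Γ t t' X} → Γ ⊩ t ∶ X → t ↦ t' →
            er t →ʰ er t' ⊎ er t ≡ er t' × irrSize t' < irrSize t
↦-er-step p (↦-β {rel} {t = t} {u}) =
  inj₁ (subst (app° (lam° (er t)) (er u) →ʰ_) (sym (er-[] t u)) →ʰ-β)
↦-er-step p (↦-β {irr} {u = u}) with β-inversion p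
... | refl , _ , q , _ = inj₂ (er-β-irr u q ,
  -- The redex measures two more than the body of its abstraction; `n≤1+n` covers the surplus.
  s≤s (≤-trans (≤-reflexive (irrSize-sub q (λ { (there x) → refl }))) (n≤1+n _)))
↦-er-step p (↦-app {a} s) with app-inversion p
... | _ , _ , q , _ with a | ↦-er-step q s
... | rel | inj₁ r       = inj₁ (→ʰ-app r)
... | rel | inj₂ (e , l) = inj₂ (cong (λ f → app° f _) e , s≤s l)
... | irr | inj₁ r       = inj₁ r
... | irr | inj₂ (e , l) = inj₂ (e , s≤s l)

headNormalizing-↘ : ∀ {Γ t X} → Γ ⊩ t ∶ X → HeadNormalizing (er t) → ∃ (t ↘_)
headNormalizing-↘ {Γ} p h = go h p refl ≤-refl
  where
  -- Lexicographic recursion: a visible step consumes head normalization and resets the bound `n`;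
  -- an invisible step keeps the erasure and lowers `n`.
  go : ∀ {t s X n} → HeadNormalizing s → Γ ⊩ t ∶ X → s ≡ er t → irrSize t < n → ∃ (t ↘_)
  go {n = suc n} h p e (s≤s l) with progress p
  ... | inj₁ w = _ , ev-whnf w
  ... | inj₂ (t' , s) with ↦-er-step p s
  go {n = suc n} h p e (s≤s l) | inj₂ (t' , s) | inj₂ (f , k)
    with go h (subject-reduction p s) (trans e f) (<-≤-trans k l)
  ... | r , q = r , ↦-↘ s q
  go (hn-whnf w) p refl (s≤s l) | inj₂ (t' , s) | inj₁ k = ⊥-elim (whnf-↛ʰ w k)
  go (hn-step k' h) p refl (s≤s l) | inj₂ (t' , s) | inj₁ k
    with go h (subject-reduction p s) (→ʰ-deterministic k' k) ≤-refl
  ... | r , q = r , ↦-↘ s q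

-- Weak head normal forms of convertible types.

infix 4 _≈ʷ_

data TypeWhnf : Tm → Head → Set where
  tw-sort : ∀ {k} → TypeWhnf (sort k) ⋆ʰ
  tw-pi   : ∀ {a i j U T} → TypeWhnf (pi a i j U T) (piʰ a)
  tw-ne   : ∀ {x n} → Ne n → Neutral x (er n) → TypeWhnf n (neʰ x)

er-neutral : ∀ {n} → Ne n → ∃ λ x → Neutral x (er n)
er-neutral ne-var = _ , neutral-var
er-neutral (ne-app {rel} n) with er-neutral n
... | x , m = x , neutral-app m
er-neutral (ne-app {irr} n) = er-neutral n

typeWhnf : ∀ {Γ A} → IsType Γ A → Whnf A → ∃ (TypeWhnf A)
typeWhnf p wh-sort   = _ , tw-sort
typeWhnf p wh-pi     = _ , tw-pi
typeWhnf p (wh-ne n) = _ , tw-ne n (proj₂ (er-neutral n))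
typeWhnf p wh-lam with lam-inversion p
... | _ , _ , e = ⊥-elim (⋆≄pi (≃-sym e))

typeWhnf-head : ∀ {A h} → TypeWhnf A h → HasHead h (er A)
typeWhnf-head tw-sort     = head-⋆
typeWhnf-head tw-pi       = head-pi
typeWhnf-head (tw-ne _ m) = head-ne m

-- This keeps just what type-directed equality inspects: it runs alike at all sorts and at all
-- neutral types.
data _≈ʷ_ : Tm → Tm → Set where
  ≈ʷ-sort : ∀ {k l} → sort k ≈ʷ sort l
  ≈ʷ-pi   : ∀ {a i j i' j' U U' T T'} → er U ≃ er U' → er T ≃ er T' →
            pi a i j U T ≈ʷ pi a i' j' U' T'
  ≈ʷ-ne   : ∀ {n n'} → Ne n → Ne n' → n ≈ʷ n'

typeWhnf-match : ∀ {A A' h h'} → TypeWhnf A h → TypeWhnf A' h' → er A ≃ er A' → A ≈ʷ A'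
typeWhnf-match w w' e with ≃-head (typeWhnf-head w) (typeWhnf-head w') e
typeWhnf-match tw-sort tw-sort e | refl = ≈ʷ-sort
typeWhnf-match tw-pi tw-pi e | refl with ≃-pi⁻¹ e
... | refl , f , g = ≈ʷ-pi f g
typeWhnf-match (tw-ne n _) (tw-ne m _) e | refl = ≈ʷ-ne n m

↘-match : ∀ {Γ Γ' T T' A A'} → IsType Γ T → IsType Γ' T' → er T ≃ er T' →
          T ↘ A → T' ↘ A' → A ≈ʷ A'
↘-match p p' e q q' with ↘-sound p q | ↘-sound p' q'
... | r , f | r' , f' = typeWhnf-match (proj₂ (typeWhnf r (↘-whnf q)))
  (proj₂ (typeWhnf r' (↘-whnf q'))) (≃-sym f ◅◅ e ◅◅ f')

-- Reversing a derivation moves it to a convertible type whose evaluation is not given.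
-- Standardization supplies a head normal form of the erasure, and `headNormalizing-↘` lifts it to
-- an evaluation.
↘-transfer : ∀ {Γ Γ' T T' A} → IsType Γ T → IsType Γ' T' → er T ≃ er T' →
             T ↘ A → ∃ λ A' → T' ↘ A' × A ≈ʷ A'
↘-transfer p p' e q with ↘-sound p q
... | r , f with headNormalizing-↘ p'
  (≃-headNormalizing (≃-sym e ◅◅ f) (typeWhnf-head (proj₂ (typeWhnf r (↘-whnf q)))))
... | A' , q' = A' , q' , ↘-match p p' e q q'

-- Soundness of algorithmic equality for untyped conversion.

TypedCtx : Ctx → Set
TypedCtx Γ = ∀ {x T} → Γ ∋ x ∶ T → IsType Γ T

typedCtx-extend : ∀ {Γ a U} → TypedCtx Γ → IsType Γ U → TypedCtx (Γ ▸ (a , U))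
typedCtx-extend c p here      = ⊩-wk p
typedCtx-extend c p (there x) = ⊩-wk (c x)

⊢-typedCtx : ∀ {Γ} → ⊢ Γ → TypedCtx Γ
⊢-typedCtx (wf-▸ w p) = typedCtx-extend (⊢-typedCtx w) (⊢⇒⊩ p)

⊩-η-body : ∀ {Γ a U t} T → Γ ⊩ t ∶ pi° a (er U) (er T) →
           Γ ▸ (a , U) ⊩ app a (wk t) (var zero) ∶ er T
⊩-η-body {a = rel} {U} T p = ⊩-cast
  (⊩-app (⊩-wk p) (⊩-cast (⊩-var here) (er-ren suc U))) (lift-wk-single-zero° (er T))
⊩-η-body {a = irr} T p = ⊩-cast (⊩-iapp (⊩-wk p)) (lift-wk-single-zero° (er T))

-- Relevant case: abstract both sides and contract by η. Irrelevant case: the application is erased,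
-- and instantiating the fresh variable undoes the weakening.
η-injective : ∀ a t t' → er (app a (wk t) (var zero)) ≃ er (app a (wk t') (var zero)) →
              er t ≃ er t'
η-injective rel t t' e = ≃-sym (≃-η (er t)) ◅◅
  ≃-lam (subst₂ (λ s s' → app° s _ ≃ app° s' _) (er-ren suc t) (er-ren suc t') e) ◅◅ ≃-η (er t')
η-injective irr t t' e = subst₂ _≃_ (unwk t) (unwk t') (≃-sub (single° ⋆°) e)
  where
  unwk : ∀ t → er (wk t) [ ⋆° ]° ≡ er t
  unwk t = trans (cong (_[ ⋆° ]°) (er-ren suc t)) (wk-single° ⋆° (er t))

-- Neutrals enter with unrelated types; a single output type for both is what makes their arguments
-- comparable at one domain.
record NeSound (Γ : Ctx) (n n' T : Tm) : Set where
  constructor neSound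
  field
    isType : IsType Γ T
    left   : Γ ⊩ n ∶ er T
    right  : Γ ⊩ n' ∶ er T
    equal  : er n ≃ er n'

-- Inversion yields some domain; uniqueness of types and injectivity convert it to the domain output
-- by the algorithm.
app-argument : ∀ {Γ a t u X Y Z} → Γ ⊩ app a t u ∶ X → Γ ⊩ t ∶ pi° a Y Z → a ≡ rel → Γ ⊩ u ∶ Y
app-argument p q e with app-inversion p
... | _ , _ , r , s , _ = ⊩-conv (s e) (proj₁ (proj₂ (≃-pi⁻¹ (⊩-unique r q))))

mutual
  ⟺ty-sound : ∀ {Γ T T'} → TypedCtx Γ → IsType Γ T → IsType Γ T' → Γ ⊢ T ⟺ty T' → er T ≃ er T'
  ⟺ty-sound c p p' (ty-eval e e' d) with ↘-sound p e | ↘-sound p' e'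
  ... | q , f | q' , f' = f ◅◅ ⟷ty-sound c q q' d ◅◅ ≃-sym f'

  ⟷ty-sound : ∀ {Γ A A'} → TypedCtx Γ → IsType Γ A → IsType Γ A' → Γ ⊢ A ⟷ty A' → er A ≃ er A'
  ⟷ty-sound c p p' tyw-sort = ≃-refl
  ⟷ty-sound c p p' (tyw-pi d e) with pi-inversion p | pi-inversion p'
  ... | q , r | q' , r' with ⟺ty-sound c q q' d
  -- The right codomain is typed under its own domain; soundness of the domain premise moves it
  -- under the left one.
  ... | f = ≃-pi f (⟺ty-sound (typedCtx-extend c q) r (⊩-≋ (≋-extend ≋-refl (≃-sym f)) r') e)
  ⟷ty-sound c p p' (tyw-ne _ _ d) = NeSound.equal (⟺ne-sound c p p' d)

  ⟺ne-sound : ∀ {Γ n n' T X X'} → TypedCtx Γ → Γ ⊩ n ∶ X → Γ ⊩ n' ∶ X' →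
              Γ ⊢ n ⟺ne n' ∶ T → NeSound Γ n n' T
  ⟺ne-sound c p p' (ne-var x) = neSound (c x) (⊩-var x) (⊩-var x) ≃-refl
  ⟺ne-sound c p p' (ne-app-rel {u = u} {u'} {T = T} d e)
    with app-inversion p | app-inversion p'
  ... | _ , _ , q , _ | _ , _ , q' , _ with ⟷ne-sound c q q' d
  ... | neSound t l r f with pi-inversion t | app-argument p l refl | app-argument p' r refl
  ... | tU , tT | v | v' with ⟺tm-sound c tU v v' e
  ... | g = neSound (⊩-[] tT (λ _ → v)) (⊩-cast (⊩-app l v) (sym (er-[] T u)))
    (⊩-conv (⊩-app r v') (≃-[] {t = er T} ≃-refl (≃-sym g) ◅◅ ≃-reflexive (sym (er-[] T u))))
    (≃-app f g)
  ⟺ne-sound c p p' (ne-app-irr {u = u} {u'} {T = T} d)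
    with app-inversion p | app-inversion p'
  ... | _ , _ , q , _ | _ , _ , q' , _ with ⟷ne-sound c q q' d
  ... | neSound t l r f with pi-inversion t
  ... | tU , tT = neSound (⊩-[] tT (λ ())) (⊩-cast (⊩-iapp l) (sym (er-[] T u)))
    (⊩-cast (⊩-iapp r) (trans (er-irr-[] (er u') (er u) tT) (sym (er-[] T u)))) f

  ⟷ne-sound : ∀ {Γ n n' A X X'} → TypedCtx Γ → Γ ⊩ n ∶ X → Γ ⊩ n' ∶ X' →
              Γ ⊢ n ⟷ne n' ∶ A → NeSound Γ n n' A
  ⟷ne-sound c p p' (ne-eval d e) with ⟺ne-sound c p p' d
  ... | neSound t l r f with ↘-sound t e
  ... | q , g = neSound q (⊩-conv l g) (⊩-conv r g) f

  ⟺tm-sound : ∀ {Γ t t' T} → TypedCtx Γ → IsType Γ T → Γ ⊩ t ∶ er T → Γ ⊩ t' ∶ er T →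
              Γ ⊢ t ⟺tm t' ∶ T → er t ≃ er t'
  ⟺tm-sound c s p p' (tm-eval e d) with ↘-sound s e
  ... | q , f = ⟷tm-sound c q (⊩-conv p f) (⊩-conv p' f) d

  ⟷tm-sound : ∀ {Γ t t' A} → TypedCtx Γ → IsType Γ A → Γ ⊩ t ∶ er A → Γ ⊩ t' ∶ er A →
              Γ ⊢ t ⟷tm t' ∶ A → er t ≃ er t'
  ⟷tm-sound c s p p' (tmw-pi {t = t} {t'} {a} {T = T} d) with pi-inversion s
  ... | tU , tT = η-injective a t t'
    (⟺tm-sound (typedCtx-extend c tU) tT (⊩-η-body T p) (⊩-η-body T p') d)
  ⟷tm-sound c s p p' (tmw-sort d) = ⟺ty-sound c p p' d
  ⟷tm-sound c s p p' (tmw-ne _ e e' _ _ d) with ↘-sound p e | ↘-sound p' e'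
  ... | q , f | q' , f' = f ◅◅ NeSound.equal (⟺ne-sound c q q' d) ◅◅ ≃-sym f'

-- Symmetry.

mutual
  ⟺ty-sym : ∀ {Γ Δ T T'} → TypedCtx Γ → TypedCtx Δ → Γ ≋ Δ → IsType Γ T → IsType Γ T' →
            Γ ⊢ T ⟺ty T' → Δ ⊢ T' ⟺ty T
  ⟺ty-sym c c' h p p' (ty-eval e e' d) =
    ty-eval e' e (⟷ty-sym c c' h (proj₁ (↘-sound p e)) (proj₁ (↘-sound p' e')) d)

  ⟷ty-sym : ∀ {Γ Δ A A'} → TypedCtx Γ → TypedCtx Δ → Γ ≋ Δ → IsType Γ A → IsType Γ A' →
            Γ ⊢ A ⟷ty A' → Δ ⊢ A' ⟷ty A
  ⟷ty-sym c c' h p p' tyw-sort = tyw-sort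
  ⟷ty-sym c c' h p p' (tyw-pi d e) with pi-inversion p | pi-inversion p'
  ... | q , r | q' , r' with ⟺ty-sound c q q' d
  ... | f = tyw-pi (⟺ty-sym c c' h q q' d)
    (⟺ty-sym (typedCtx-extend c q) (typedCtx-extend c' (⊩-≋ h q')) (≋-extend h f)
      r (⊩-≋ (≋-extend ≋-refl (≃-sym f)) r') e)
  ⟷ty-sym c c' h p p' (tyw-ne n n' d) with ⟺ne-sym c c' h p p' d
  ... | _ , d' , _ = tyw-ne n' n d'

  -- The output type cannot be kept: it mentions the left argument, which reversal replaces by the
  -- right one.
  ⟺ne-sym : ∀ {Γ Δ n n' T X X'} → TypedCtx Γ → TypedCtx Δ → Γ ≋ Δ → Γ ⊩ n ∶ X → Γ ⊩ n' ∶ X' →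
            Γ ⊢ n ⟺ne n' ∶ T → ∃ λ T' → Δ ⊢ n' ⟺ne n ∶ T' × er T ≃ er T'
  ⟺ne-sym c c' h p p' (ne-var x) with h x
  ... | T' , y , e = T' , ne-var y , e
  ⟺ne-sym c c' h p p' (ne-app-rel {u = u} {u'} {T = T} d e)
    with app-inversion p | app-inversion p'
  ... | _ , _ , q , _ | _ , _ , q' , _ with ⟷ne-sound c q q' d | ⟷ne-sym c c' h q q' d
  ... | neSound t l r _ | _ , d' , tP , ≈ʷ-pi {T' = T'} f g
    with pi-inversion t | pi-inversion tP | app-argument p l refl | app-argument p' r refl
  ... | tU , _ | tU' , _ | v | v' =
    _ , ne-app-rel d' (⟺tm-sym c c' h tU tU' f v v' e) ,
    ≃-reflexive (er-[] T u) ◅◅ ≃-[] g (⟺tm-sound c tU v v' e) ◅◅ ≃-reflexive (sym (er-[] T' u'))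
  ⟺ne-sym c c' h p p' (ne-app-irr {u = u} {u'} {T = T} d)
    with app-inversion p | app-inversion p'
  ... | _ , _ , q , _ | _ , _ , q' , _ with ⟷ne-sound c q q' d | ⟷ne-sym c c' h q q' d
  ... | neSound t l r _ | _ , d' , tP , ≈ʷ-pi {T' = T'} f g
    with pi-inversion t
  ... | _ , tT =
    _ , ne-app-irr d' ,
    ≃-reflexive (trans (er-[] T u) (er-irr-[] (er u) (er u') tT)) ◅◅ ≃-[] g ≃-refl ◅◅
      ≃-reflexive (sym (er-[] T' u'))

  ⟷ne-sym : ∀ {Γ Δ n n' A X X'} → TypedCtx Γ → TypedCtx Δ → Γ ≋ Δ → Γ ⊩ n ∶ X → Γ ⊩ n' ∶ X' →
            Γ ⊢ n ⟷ne n' ∶ A → ∃ λ A' → Δ ⊢ n' ⟷ne n ∶ A' × IsType Δ A' × A ≈ʷ A'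
  ⟷ne-sym c c' h p p' (ne-eval d e) with ⟺ne-sound c p p' d | ⟺ne-sym c c' h p p' d
  ... | s | T' , d' , f with ⟺ne-sound c' (⊩-≋ h p') (⊩-≋ h p) d'
  ... | s' with ↘-transfer (NeSound.isType s) (NeSound.isType s') f e
  ... | A' , e' , m = A' , ne-eval d' e' , proj₁ (↘-sound (NeSound.isType s') e') , m

  -- `T'` may differ from `T` because arguments are compared at the domain of an output type, which
  -- `⟷ne-sym` changes.
  ⟺tm-sym : ∀ {Γ Δ t t' T T'} → TypedCtx Γ → TypedCtx Δ → Γ ≋ Δ → IsType Γ T → IsType Δ T' →
            er T ≃ er T' → Γ ⊩ t ∶ er T → Γ ⊩ t' ∶ er T →
            Γ ⊢ t ⟺tm t' ∶ T → Δ ⊢ t' ⟺tm t ∶ T'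
  ⟺tm-sym c c' h s s' f p p' (tm-eval e d) with ↘-sound s e | ↘-transfer s s' f e
  ... | q , g | A' , e' , m = tm-eval e'
    (⟷tm-sym c c' h q (proj₁ (↘-sound s' e')) m (⊩-conv p g) (⊩-conv p' g) d)

  ⟷tm-sym : ∀ {Γ Δ t t' A A'} → TypedCtx Γ → TypedCtx Δ → Γ ≋ Δ → IsType Γ A → IsType Δ A' →
            A ≈ʷ A' → Γ ⊩ t ∶ er A → Γ ⊩ t' ∶ er A →
            Γ ⊢ t ⟷tm t' ∶ A → Δ ⊢ t' ⟷tm t ∶ A'
  ⟷tm-sym c c' h s s' (≈ʷ-pi f g) p p' (tmw-pi {T = T} d) with pi-inversion s | pi-inversion s'
  ... | tU , tT | tU' , tT' = tmw-pi
    (⟺tm-sym (typedCtx-extend c tU) (typedCtx-extend c' tU') (≋-extend h f) tT tT' g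
      (⊩-η-body T p) (⊩-η-body T p') d)
  ⟷tm-sym c c' h s s' ≈ʷ-sort p p' (tmw-sort d) = tmw-sort (⟺ty-sym c c' h p p' d)
  ⟷tm-sym c c' h s s' (≈ʷ-ne _ N') p p' (tmw-ne _ e e' n n' d)
    with ⟺ne-sym c c' h (proj₁ (↘-sound p e)) (proj₁ (↘-sound p' e')) d
  ... | _ , d' , _ = tmw-ne N' e' e n' n d'

-- Transitivity.

mutual
  ⟺ty-trans : ∀ {Γ Δ T₁ T₂ T₃} → TypedCtx Γ → TypedCtx Δ → Γ ≋ Δ →
              IsType Γ T₁ → IsType Γ T₂ → IsType Δ T₃ →
              Γ ⊢ T₁ ⟺ty T₂ → Δ ⊢ T₂ ⟺ty T₃ → Γ ⊢ T₁ ⟺ty T₃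
  ⟺ty-trans c c' h p₁ p₂ p₃ (ty-eval e₁ e₂ d) (ty-eval e₂' e₃ d') with ↘-deterministic e₂ e₂'
  ... | refl = ty-eval e₁ e₃ (⟷ty-trans c c' h (proj₁ (↘-sound p₁ e₁)) (proj₁ (↘-sound p₂ e₂))
    (proj₁ (↘-sound p₃ e₃)) d d')

  ⟷ty-trans : ∀ {Γ Δ A₁ A₂ A₃} → TypedCtx Γ → TypedCtx Δ → Γ ≋ Δ →
              IsType Γ A₁ → IsType Γ A₂ → IsType Δ A₃ →
              Γ ⊢ A₁ ⟷ty A₂ → Δ ⊢ A₂ ⟷ty A₃ → Γ ⊢ A₁ ⟷ty A₃
  -- A sort is related only to itself, so the derivation over `Δ` is rebuilt over `Γ`.
  ⟷ty-trans c c' h p₁ p₂ p₃ tyw-sort d' = sort-ty d'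
    where
    sort-ty : ∀ {k A} → _ ⊢ sort k ⟷ty A → _ ⊢ sort k ⟷ty A
    sort-ty tyw-sort = tyw-sort
    sort-ty (tyw-ne () _ _)
  ⟷ty-trans c c' h p₁ p₂ p₃ (tyw-pi d e) (tyw-pi d' e')
    with pi-inversion p₁ | pi-inversion p₂ | pi-inversion p₃
  ... | q₁ , r₁ | q₂ , r₂ | q₃ , r₃
    with ⟺ty-sound c q₁ q₂ d | ⟺ty-sound c' (⊩-≋ h q₂) q₃ d'
  ... | f | f' = tyw-pi (⟺ty-trans c c' h q₁ q₂ q₃ d d')
    (⟺ty-trans (typedCtx-extend c q₁) (typedCtx-extend c' (⊩-≋ h q₂)) (≋-extend h f) r₁
      (⊩-≋ (≋-extend ≋-refl (≃-sym f)) r₂) (⊩-≋ (≋-extend ≋-refl (≃-sym f')) r₃) e e')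
  ⟷ty-trans c c' h p₁ p₂ p₃ (tyw-pi _ _) (tyw-ne () _ _)
  ⟷ty-trans c c' h p₁ p₂ p₃ (tyw-ne _ () _) tyw-sort
  ⟷ty-trans c c' h p₁ p₂ p₃ (tyw-ne _ () _) (tyw-pi _ _)
  ⟷ty-trans c c' h p₁ p₂ p₃ (tyw-ne n₁ n₂ d) (tyw-ne _ n₃ d') =
    tyw-ne n₁ n₃ (proj₁ (⟺ne-trans c c' h p₁ p₂ p₃ d d'))

  -- The first derivation fixes the output type; convertibility with that of the second lets the
  -- argument derivations, run at different domains, be composed.
  ⟺ne-trans : ∀ {Γ Δ n₁ n₂ n₃ T T' X₁ X₂ X₃} → TypedCtx Γ → TypedCtx Δ → Γ ≋ Δ →
              Γ ⊩ n₁ ∶ X₁ → Γ ⊩ n₂ ∶ X₂ → Δ ⊩ n₃ ∶ X₃ →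
              Γ ⊢ n₁ ⟺ne n₂ ∶ T → Δ ⊢ n₂ ⟺ne n₃ ∶ T' → Γ ⊢ n₁ ⟺ne n₃ ∶ T × er T ≃ er T'
  ⟺ne-trans c c' h p₁ p₂ p₃ (ne-var x) (ne-var y) with h x
  ... | _ , y' , e with ∋-unique y y'
  ... | refl = ne-var x , e
  ⟺ne-trans c c' h p₁ p₂ p₃ (ne-app-rel {u = u₁} {u₂} {T = T} d e) (ne-app-rel {T = T'} d' e')
    with app-inversion p₁ | app-inversion p₂ | app-inversion p₃
  ... | _ , _ , q₁ , _ | _ , _ , q₂ , _ | _ , _ , q₃ , _
    with ⟷ne-sound c q₁ q₂ d | ⟷ne-sound c' (⊩-≋ h q₂) q₃ d' | ⟷ne-trans c c' h q₁ q₂ q₃ d d'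
  ... | neSound t l r _ | neSound t' l' r' _ | d'' , ≈ʷ-pi f g
    with pi-inversion t | pi-inversion t' | app-argument p₁ l refl | app-argument p₂ r refl
       | app-argument p₃ r' refl
  ... | tU , _ | tU' , _ | v₁ | v₂ | v₃ =
    ne-app-rel d'' (⟺tm-trans c c' h tU tU' f v₁ v₂ v₃ e e') ,
    ≃-reflexive (er-[] T u₁) ◅◅ ≃-[] g (⟺tm-sound c tU v₁ v₂ e) ◅◅ ≃-reflexive (sym (er-[] T' u₂))
  ⟺ne-trans c c' h p₁ p₂ p₃ (ne-app-irr {u = u₁} {u₂} {T = T} d) (ne-app-irr {T = T'} d')
    with app-inversion p₁ | app-inversion p₂ | app-inversion p₃
  ... | _ , _ , q₁ , _ | _ , _ , q₂ , _ | _ , _ , q₃ , _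
    with ⟷ne-sound c q₁ q₂ d | ⟷ne-trans c c' h q₁ q₂ q₃ d d'
  ... | neSound t _ _ _ | d'' , ≈ʷ-pi f g =
    ne-app-irr d'' ,
    ≃-reflexive (trans (er-[] T u₁) (er-irr-[] (er u₁) (er u₂) (proj₂ (pi-inversion t)))) ◅◅
      ≃-[] g ≃-refl ◅◅ ≃-reflexive (sym (er-[] T' u₂))

  ⟷ne-trans : ∀ {Γ Δ n₁ n₂ n₃ A A' X₁ X₂ X₃} → TypedCtx Γ → TypedCtx Δ → Γ ≋ Δ →
              Γ ⊩ n₁ ∶ X₁ → Γ ⊩ n₂ ∶ X₂ → Δ ⊩ n₃ ∶ X₃ →
              Γ ⊢ n₁ ⟷ne n₂ ∶ A → Δ ⊢ n₂ ⟷ne n₃ ∶ A' → Γ ⊢ n₁ ⟷ne n₃ ∶ A × A ≈ʷ A'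
  ⟷ne-trans c c' h p₁ p₂ p₃ (ne-eval d e) (ne-eval d' e')
    with ⟺ne-sound c p₁ p₂ d | ⟺ne-sound c' (⊩-≋ h p₂) p₃ d' | ⟺ne-trans c c' h p₁ p₂ p₃ d d'
  ... | s | s' | d'' , f =
    ne-eval d'' e , ↘-match (NeSound.isType s) (NeSound.isType s') f e e'

  ⟺tm-trans : ∀ {Γ Δ t₁ t₂ t₃ T T'} → TypedCtx Γ → TypedCtx Δ → Γ ≋ Δ →
              IsType Γ T → IsType Δ T' → er T ≃ er T' →
              Γ ⊩ t₁ ∶ er T → Γ ⊩ t₂ ∶ er T → Δ ⊩ t₃ ∶ er T' →
              Γ ⊢ t₁ ⟺tm t₂ ∶ T → Δ ⊢ t₂ ⟺tm t₃ ∶ T' → Γ ⊢ t₁ ⟺tm t₃ ∶ T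
  ⟺tm-trans c c' h s s' f p₁ p₂ p₃ (tm-eval e d) (tm-eval e' d') with ↘-sound s e | ↘-sound s' e'
  ... | q , g | q' , g' = tm-eval e (⟷tm-trans c c' h q q' (↘-match s s' f e e')
    (⊩-conv p₁ g) (⊩-conv p₂ g) (⊩-conv p₃ g') d d')

  ⟷tm-trans : ∀ {Γ Δ t₁ t₂ t₃ A A'} → TypedCtx Γ → TypedCtx Δ → Γ ≋ Δ →
              IsType Γ A → IsType Δ A' → A ≈ʷ A' →
              Γ ⊩ t₁ ∶ er A → Γ ⊩ t₂ ∶ er A → Δ ⊩ t₃ ∶ er A' →
              Γ ⊢ t₁ ⟷tm t₂ ∶ A → Δ ⊢ t₂ ⟷tm t₃ ∶ A' → Γ ⊢ t₁ ⟷tm t₃ ∶ A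
  ⟷tm-trans c c' h s s' (≈ʷ-pi f g) p₁ p₂ p₃ (tmw-pi {T = T} d) (tmw-pi {T = T'} d')
    with pi-inversion s | pi-inversion s'
  ... | tU , tT | tU' , tT' = tmw-pi
    (⟺tm-trans (typedCtx-extend c tU) (typedCtx-extend c' tU') (≋-extend h f) tT tT' g
      (⊩-η-body T p₁) (⊩-η-body T p₂) (⊩-η-body T' p₃) d d')
  ⟷tm-trans c c' h s s' ≈ʷ-sort p₁ p₂ p₃ (tmw-sort d) (tmw-sort d') =
    tmw-sort (⟺ty-trans c c' h p₁ p₂ p₃ d d')
  ⟷tm-trans c c' h s s' _ p₁ p₂ p₃ (tmw-ne N e₁ e₂ n₁ _ d) (tmw-ne _ e₂' e₃ _ n₃ d')
    with ↘-deterministic e₂ e₂'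
  ... | refl = tmw-ne N e₁ e₃ n₁ n₃ (proj₁ (⟺ne-trans c c' h (proj₁ (↘-sound p₁ e₁))
    (proj₁ (↘-sound p₂ e₂)) (proj₁ (↘-sound p₃ e₃)) d d'))

theorem5p15 : (Δ : Ctx) → ⊢ Δ →
    PEROn (λ T → Δ ⊢Ty T) (λ T T' → Δ ⊢ T ⟺ty T')
    × ((T : Tm) → Δ ⊢Ty T → PEROn (λ t → Δ ⊢ t ∶ T) (λ t t' → Δ ⊢ t ⟺tm t' ∶ T))
    × PEROn (Typable Δ) (NeRel Δ)
theorem5p15 Δ ⊢Δ =
  ((λ (_ , p) (_ , q) → ⟺ty-sym c c ≋-refl (⊢⇒⊩ p) (⊢⇒⊩ q)) ,
   (λ (_ , p) (_ , q) (_ , r) → ⟺ty-trans c c ≋-refl (⊢⇒⊩ p) (⊢⇒⊩ q) (⊢⇒⊩ r))) ,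
  (λ { T (_ , s) →
    (λ p q → ⟺tm-sym c c ≋-refl (⊢⇒⊩ s) (⊢⇒⊩ s) ≃-refl (⊢⇒⊩ p) (⊢⇒⊩ q)) ,
    (λ p q r → ⟺tm-trans c c ≋-refl (⊢⇒⊩ s) (⊢⇒⊩ s) ≃-refl (⊢⇒⊩ p) (⊢⇒⊩ q) (⊢⇒⊩ r)) }) ,
  (λ { (_ , p) (_ , q) (_ , d) → let U , e , _ = ⟺ne-sym c c ≋-refl (⊢⇒⊩ p) (⊢⇒⊩ q) d in U , e }) ,
  (λ { (_ , p) (_ , q) (_ , r) (U , d) (_ , d') →
    U , proj₁ (⟺ne-trans c c ≋-refl (⊢⇒⊩ p) (⊢⇒⊩ q) (⊢⇒⊩ r) d d') })
  where
  c : TypedCtx Δ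
  c = ⊢-typedCtx ⊢Δ
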